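{- Let $k\ge 1$ be an integer and let $k'$ be an odd integer with $k'>2k+1$. Let $G_1$ be the disjoint union of the cycle $C_{4(k+1)}$ and two copies of the path $P_{k'}$, and let $G_2$ be the disjoint union of the cycle $C_{2(k'+1)}$ and two copies of the path $P_{2k+1}$. Then $G_1$ and $G_2$ are half-regular bipartite graphs with the same degree sequences and the same spectrum. Moreover, the disjoint unions $G_1\cup C_{4(k+1)}$ and $G_2\cup C_{4(k+1)}$ both have girth $4(k+1)$ but have different numbers of cycles of length $2(k'+1)$.
   Context: All graphs are finite, simple and undirected. $C_n$ denotes a cycle of length $n$ and $P_n$ a path with $n$ nodes. The spectrum of a graph is the multiset of eigenvalues of its adjacency matrix. The degree sequences of a bipartite graph are the two monotonic non-increasing sequences of the node degrees on the two sides of a bipartition; two graphs have the same degree sequences if these coincide for suitable bipartitions. A bipartite graph is half-regular if, for a suitable bipartition, all nodes on one side have the same degree. Half-regular graphs are regarded as not bi-regular (bi-regular meaning that all nodes on the same side have the same degree, for both sides). Cycles are counted as subgraphs. The girth is the length of a shortest cycle. -}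

module Defs where

open import Algebra.Bundles using (CommutativeRing)
import Algebra.Properties.Monoid.Sum as MonoidSum
open import Data.Bool.Base using (Bool; true; false; _∧_; _∨_; if_then_else_)
import Data.Bool.Properties as Bool
open import Data.Fin.Base using (Fin; toℕ; splitAt)
open import Data.Fin.Subset using (Subset; _∈_; ∣_∣)
open import Data.List.Base using (List; length; map; filter; allFin)
import Data.List.Membership.Propositional as List
open import Data.List.Relation.Unary.Unique.Propositional using (Unique)
import Data.List.Sort as Sort
open import Data.Nat.Base as ℕ
  using (ℕ; suc; _≡ᵇ_; _<ᵇ_; ∣_-_∣; _⊔_)
import Data.Nat.Properties as ℕ
open import Data.Product.Base using (∃; ∃-syntax; ∃₂; _×_; _,_; proj₁; proj₂)
open import Data.Rational.Base as ℚ using (ℚ; 0ℚ; 1ℚ; ½)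
import Data.Rational.Properties as ℚ
open import Data.Rational.Solver using (module +-*-Solver)
open import Data.Sum.Base using (_⊎_; inj₁; inj₂)
open import Data.Vec.Base using (Vec; tabulate; lookup)
open import Data.Vec.Functional using (Vector)
open import Function.Bundles using (_⇔_)
open import Function.Definitions using (Injective)
open import Level using (0ℓ)
import Relation.Binary.Construct.Flip.EqAndOrd as Flip
open import Relation.Binary.PropositionalEquality
  using (_≡_; _≢_; refl; sym; trans; cong; subst)
open import Relation.Nullary using (¬_)

------------------------------------------------------------------------
-- Real numbers

-- x ∼ y: the terms of x and of y get arbitrarily close.  Thus x ∼ x is
-- exactly the Cauchy condition, and for Cauchy x, y the relation x ∼ y
-- is equivalent to x n - y n → 0.

infix 4 _∼_

_∼_ : (ℕ → ℚ) → (ℕ → ℚ) → Set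
x ∼ y = ∀ ε → 0ℚ ℚ.< ε →
        ∃[ N ] (∀ m n → N ℕ.≤ m → N ℕ.≤ n → ℚ.∣ x m ℚ.- y n ∣ ℚ.< ε)

IsCauchy : (ℕ → ℚ) → Set
IsCauchy x = x ∼ x

record ℝ : Set where
  constructor mkℝ
  field
    seq    : ℕ → ℚ
    cauchy : IsCauchy seq

open ℝ public

infix 4 _≃_

-- A record, so that x and y can be inferred from x ≃ y.
record _≃_ (x y : ℝ) : Set where
  constructor mk≃
  field
    close : seq x ∼ seq y

open _≃_ public

module _ where

  open +-*-Solver using (solve; _:=_; _:+_; _:*_; _:-_; :-_)

  private

    half-pos : ∀ {ε} → 0ℚ ℚ.< ε → 0ℚ ℚ.< ½ ℚ.* ε
    half-pos {ε} 0<ε =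
      ℚ.positive⁻¹ (½ ℚ.* ε) {{ℚ.pos*pos⇒pos ½ ε {{ℚ.positive 0<ε}}}}

    half+half : ∀ ε → ½ ℚ.* ε ℚ.+ ½ ℚ.* ε ≡ ε
    half+half ε = trans (sym (ℚ.*-distribʳ-+ ε ½ ½)) (ℚ.*-identityˡ ε)

    -- |a| < ε/2 and |b| < ε/2 bound |c| when c = a + b.
    split< : ∀ {a b c ε} → c ≡ a ℚ.+ b → ℚ.∣ a ∣ ℚ.< ½ ℚ.* ε →
             ℚ.∣ b ∣ ℚ.< ½ ℚ.* ε → ℚ.∣ c ∣ ℚ.< ε
    split< {a} {b} {c} {ε} c≡a+b a< b< = begin-strict
      ℚ.∣ c ∣                  ≡⟨ cong ℚ.∣_∣ c≡a+b ⟩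
      ℚ.∣ a ℚ.+ b ∣            ≤⟨ ℚ.∣p+q∣≤∣p∣+∣q∣ a b ⟩
      ℚ.∣ a ∣ ℚ.+ ℚ.∣ b ∣      <⟨ ℚ.+-mono-< a< b< ⟩
      ½ ℚ.* ε ℚ.+ ½ ℚ.* ε      ≡⟨ half+half ε ⟩
      ε                        ∎
      where open ℚ.≤-Reasoning

    ∣-∣-swap : ∀ p q → ℚ.∣ p ℚ.- q ∣ ≡ ℚ.∣ q ℚ.- p ∣
    ∣-∣-swap p q = trans (sym (ℚ.∣-p∣≡∣p∣ (p ℚ.- q)))
      (cong ℚ.∣_∣ (solve 2 (λ a b → :- (a :- b) := b :- a) refl p q))

  ∼-sym : ∀ {x y} → x ∼ y → y ∼ x
  ∼-sym {x} {y} x∼y ε 0<ε with N , h ← x∼y ε 0<ε =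
    N , λ m n N≤m N≤n → subst (ℚ._< ε) (∣-∣-swap (x n) (y m)) (h n m N≤n N≤m)

  ∼-trans : ∀ {x y z} → x ∼ y → y ∼ z → x ∼ z
  ∼-trans {x} {y} {z} x∼y y∼z ε 0<ε
    with M , f ← x∼y (½ ℚ.* ε) (half-pos 0<ε)
       | N , g ← y∼z (½ ℚ.* ε) (half-pos 0<ε) =
    M ⊔ N , λ m n M⊔N≤m M⊔N≤n → split<
      (solve 3 (λ a b c → a :- c := (a :- b) :+ (b :- c)) refl
             (x m) (y (M ⊔ N)) (z n))
      (f m (M ⊔ N) (ℕ.m⊔n≤o⇒m≤o M N M⊔N≤m) (ℕ.m≤m⊔n M N))
      (g (M ⊔ N) n (ℕ.m≤n⊔m M N) (ℕ.m⊔n≤o⇒n≤o M N M⊔N≤n))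

  ∼-const : ∀ p → (λ _ → p) ∼ (λ _ → p)
  ∼-const p ε 0<ε =
    0 , λ _ _ _ _ → subst (ℚ._< ε) (sym (cong ℚ.∣_∣ (ℚ.+-inverseʳ p))) 0<ε

  ∼-neg : ∀ {x y} → x ∼ y → (λ n → ℚ.- x n) ∼ (λ n → ℚ.- y n)
  ∼-neg {x} {y} x∼y ε 0<ε with N , h ← x∼y ε 0<ε =
    N , λ m n N≤m N≤n → subst (ℚ._< ε)
      (trans (∣-∣-swap (x m) (y n)) (cong ℚ.∣_∣
        (solve 2 (λ a b → b :- a := (:- a) :- (:- b)) refl (x m) (y n))))
      (h m n N≤m N≤n)

  ∼-+ : ∀ {x x′ y y′} → x ∼ x′ → y ∼ y′ →
        (λ n → x n ℚ.+ y n) ∼ (λ n → x′ n ℚ.+ y′ n)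
  ∼-+ {x} {x′} {y} {y′} x∼x′ y∼y′ ε 0<ε
    with M , f ← x∼x′ (½ ℚ.* ε) (half-pos 0<ε)
       | N , g ← y∼y′ (½ ℚ.* ε) (half-pos 0<ε) =
    M ⊔ N , λ m n M⊔N≤m M⊔N≤n → split<
      (solve 4 (λ a b c d → (a :+ b) :- (c :+ d) := (a :- c) :+ (b :- d)) refl
             (x m) (y m) (x′ n) (y′ n))
      (f m n (ℕ.m⊔n≤o⇒m≤o M N M⊔N≤m) (ℕ.m⊔n≤o⇒m≤o M N M⊔N≤n))
      (g m n (ℕ.m⊔n≤o⇒n≤o M N M⊔N≤m) (ℕ.m⊔n≤o⇒n≤o M N M⊔N≤n))

  private

    record EventuallyBounded (x : ℕ → ℚ) : Set where
      field
        bound  : ℚ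
        bound+ : ℚ.Positive bound
        from   : ℕ
        below  : ∀ m → from ℕ.≤ m → ℚ.∣ x m ∣ ℚ.≤ bound

    ∼⇒bounded : ∀ {x y} → x ∼ y → EventuallyBounded x
    ∼⇒bounded {x} {y} x∼y with N , h ← x∼y 1ℚ (ℚ.positive⁻¹ 1ℚ) = record
      { bound  = 1ℚ ℚ.+ ℚ.∣ y N ∣
      ; bound+ = ℚ.pos+nonNeg⇒pos 1ℚ ℚ.∣ y N ∣ {{ℚ.∣-∣-nonNeg (y N)}}
      ; from   = N
      ; below  = λ m N≤m → begin
          ℚ.∣ x m ∣
            ≡⟨ cong ℚ.∣_∣ (solve 2 (λ a b → a := (a :- b) :+ b) refl (x m) (y N)) ⟩
          ℚ.∣ (x m ℚ.- y N) ℚ.+ y N ∣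
            ≤⟨ ℚ.∣p+q∣≤∣p∣+∣q∣ (x m ℚ.- y N) (y N) ⟩
          ℚ.∣ x m ℚ.- y N ∣ ℚ.+ ℚ.∣ y N ∣
            ≤⟨ ℚ.+-monoˡ-≤ ℚ.∣ y N ∣ (ℚ.<⇒≤ (h m N N≤m ℕ.≤-refl)) ⟩
          1ℚ ℚ.+ ℚ.∣ y N ∣ ∎
      }
      where open ℚ.≤-Reasoning

    -- For B > 0, a multiple of ε small enough to absorb a factor B.
    shrink : (B : ℚ) → ℚ.Positive B → ∀ ε → 0ℚ ℚ.< ε →
             ∃[ δ ] (0ℚ ℚ.< δ × B ℚ.* δ ≡ ε)
    shrink B B+ ε 0<ε = δ , 0<δ , Bδ≡ε
      where
      instance
        _ = B+
        _ = ℚ.pos⇒nonZero B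
        _ = ℚ.1/pos⇒pos B
        _ = ℚ.positive 0<ε
      δ = ℚ.1/ B ℚ.* ε
      0<δ : 0ℚ ℚ.< δ
      0<δ = ℚ.positive⁻¹ δ {{ℚ.pos*pos⇒pos (ℚ.1/ B) ε}}
      Bδ≡ε : B ℚ.* δ ≡ ε
      Bδ≡ε = trans (sym (ℚ.*-assoc B (ℚ.1/ B) ε))
        (trans (cong (ℚ._* ε) (ℚ.*-inverseʳ B)) (ℚ.*-identityˡ ε))

    bounded* : ∀ {a b B δ ε} → ℚ.Positive B → ℚ.∣ a ∣ ℚ.≤ B → ℚ.∣ b ∣ ℚ.< δ →
               B ℚ.* δ ≡ ε → ℚ.∣ a ℚ.* b ∣ ℚ.< ε
    bounded* {a} {b} {B} {δ} {ε} B+ a≤B b<δ Bδ≡ε = begin-strict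
      ℚ.∣ a ℚ.* b ∣          ≡⟨ ℚ.∣p*q∣≡∣p∣*∣q∣ a b ⟩
      ℚ.∣ a ∣ ℚ.* ℚ.∣ b ∣    ≤⟨ ℚ.*-monoʳ-≤-nonNeg ℚ.∣ b ∣ {{ℚ.∣-∣-nonNeg b}} a≤B ⟩
      B ℚ.* ℚ.∣ b ∣          <⟨ ℚ.*-monoʳ-<-pos B {{B+}} b<δ ⟩
      B ℚ.* δ                ≡⟨ Bδ≡ε ⟩
      ε                      ∎
      where open ℚ.≤-Reasoning

  ∼-* : ∀ {x x′ y y′} → x ∼ x′ → y ∼ y′ →
        (λ n → x n ℚ.* y n) ∼ (λ n → x′ n ℚ.* y′ n)
  ∼-* {x} {x′} {y} {y′} x∼x′ y∼y′ ε 0<ε =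
    (M ⊔ N) ⊔ (X.from ⊔ Y.from) , λ m n p q →
      let p₁ = ℕ.m⊔n≤o⇒m≤o (M ⊔ N) (X.from ⊔ Y.from) p
          p₂ = ℕ.m⊔n≤o⇒n≤o (M ⊔ N) (X.from ⊔ Y.from) p
          q₁ = ℕ.m⊔n≤o⇒m≤o (M ⊔ N) (X.from ⊔ Y.from) q
          q₂ = ℕ.m⊔n≤o⇒n≤o (M ⊔ N) (X.from ⊔ Y.from) q
      in split<
        (solve 4 (λ a b c d → (a :* b) :- (c :* d)
                           := (a :* (b :- d)) :+ (d :* (a :- c))) refl
               (x m) (y m) (x′ n) (y′ n))
        (bounded* {a = x m} X.bound+ (X.below m (ℕ.m⊔n≤o⇒m≤o X.from Y.from p₂))
          (g m n (ℕ.m⊔n≤o⇒n≤o M N p₁) (ℕ.m⊔n≤o⇒n≤o M N q₁)) Bδ≡ε/2)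
        (bounded* {a = y′ n} Y.bound+ (Y.below n (ℕ.m⊔n≤o⇒n≤o X.from Y.from q₂))
          (f m n (ℕ.m⊔n≤o⇒m≤o M N p₁) (ℕ.m⊔n≤o⇒m≤o M N q₁)) Cη≡ε/2)
    where
    module X = EventuallyBounded (∼⇒bounded {x} {x′} x∼x′)
    module Y = EventuallyBounded (∼⇒bounded {y′} {y} (∼-sym {y} {y′} y∼y′))
    for-y = shrink X.bound X.bound+ (½ ℚ.* ε) (half-pos 0<ε)
    for-x = shrink Y.bound Y.bound+ (½ ℚ.* ε) (half-pos 0<ε)
    Bδ≡ε/2 = proj₂ (proj₂ for-y)
    Cη≡ε/2 = proj₂ (proj₂ for-x)
    M = proj₁ (x∼x′ (proj₁ for-x) (proj₁ (proj₂ for-x)))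
    f = proj₂ (x∼x′ (proj₁ for-x) (proj₁ (proj₂ for-x)))
    N = proj₁ (y∼y′ (proj₁ for-y) (proj₁ (proj₂ for-y)))
    g = proj₂ (y∼y′ (proj₁ for-y) (proj₁ (proj₂ for-y)))

infixl 6 _+ᴿ_
infixl 7 _*ᴿ_
infix  8 -ᴿ_

fromℚ : ℚ → ℝ
fromℚ p = mkℝ (λ _ → p) (∼-const p)

0ᴿ 1ᴿ : ℝ
0ᴿ = fromℚ 0ℚ
1ᴿ = fromℚ 1ℚ

_+ᴿ_ _*ᴿ_ : ℝ → ℝ → ℝ
x +ᴿ y = mkℝ (λ n → seq x n ℚ.+ seq y n) (∼-+ {seq x} {seq x} {seq y} {seq y} (cauchy x) (cauchy y))
x *ᴿ y = mkℝ (λ n → seq x n ℚ.* seq y n) (∼-* {seq x} {seq x} {seq y} {seq y} (cauchy x) (cauchy y))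

-ᴿ_ : ℝ → ℝ
-ᴿ x = mkℝ (λ n → ℚ.- seq x n) (∼-neg {seq x} {seq x} (cauchy x))

pointwise : ∀ {x y} → (∀ n → seq x n ≡ seq y n) → x ≃ y
pointwise {x} {y} x≡y = mk≃ λ ε 0<ε →
  let N , h = cauchy x ε 0<ε in
  N , λ m n N≤m N≤n →
    subst (λ p → ℚ.∣ seq x m ℚ.- p ∣ ℚ.< ε) (x≡y n) (h m n N≤m N≤n)

ℝ-commutativeRing : CommutativeRing 0ℓ 0ℓ
ℝ-commutativeRing = record
  { Carrier = ℝ ; _≈_ = _≃_ ; _+_ = _+ᴿ_ ; _*_ = _*ᴿ_ ; -_ = -ᴿ_
  ; 0# = 0ᴿ ; 1# = 1ᴿ
  ; isCommutativeRing = record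
    { isRing = record
      { +-isAbelianGroup = record
        { isGroup = record
          { isMonoid = record
            { isSemigroup = record
              { isMagma = record
                { isEquivalence = record
                  { refl  = λ {x} → mk≃ (cauchy x)
                  ; sym   = λ {x} {y} p → mk≃ (∼-sym {seq x} {seq y} (close p))
                  ; trans = λ {x} {y} {z} p q →
                      mk≃ (∼-trans {seq x} {seq y} {seq z} (close p) (close q))
                  }
                ; ∙-cong = λ {x} {x′} {y} {y′} p q →
          mk≃ (∼-+ {seq x} {seq x′} {seq y} {seq y′} (close p) (close q))
                }
              ; assoc = λ x y z → pointwise λ n → ℚ.+-assoc (seq x n) (seq y n) (seq z n)
              }
            ; identity = (λ x → pointwise λ n → ℚ.+-identityˡ (seq x n))
                       , (λ x → pointwise λ n → ℚ.+-identityʳ (seq x n))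
            }
          ; inverse = (λ x → pointwise λ n → ℚ.+-inverseˡ (seq x n))
                    , (λ x → pointwise λ n → ℚ.+-inverseʳ (seq x n))
          ; ⁻¹-cong = λ {x} {y} p → mk≃ (∼-neg {seq x} {seq y} (close p))
          }
        ; comm = λ x y → pointwise λ n → ℚ.+-comm (seq x n) (seq y n)
        }
      ; *-cong = λ {x} {x′} {y} {y′} p q →
          mk≃ (∼-* {seq x} {seq x′} {seq y} {seq y′} (close p) (close q))
      ; *-assoc = λ x y z → pointwise λ n → ℚ.*-assoc (seq x n) (seq y n) (seq z n)
      ; *-identity = (λ x → pointwise λ n → ℚ.*-identityˡ (seq x n))
                   , (λ x → pointwise λ n → ℚ.*-identityʳ (seq x n))
      ; distrib = (λ x y z → pointwise λ n → ℚ.*-distribˡ-+ (seq x n) (seq y n) (seq z n))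
                , (λ x y z → pointwise λ n → ℚ.*-distribʳ-+ (seq x n) (seq y n) (seq z n))
      }
    ; *-comm = λ x y → pointwise λ n → ℚ.*-comm (seq x n) (seq y n)
    }
  }

------------------------------------------------------------------------
-- Eigenvalues and their multiplicities

module Eigen {c ℓ} (R : CommutativeRing c ℓ) where

  open CommutativeRing R
  open MonoidSum +-monoid using (sum)

  Matrix : ℕ → Set c
  Matrix n = Fin n → Fin n → Carrier

  infixr 7 _*ᵥ_

  _*ᵥ_ : ∀ {n} → Matrix n → Vector Carrier n → Vector Carrier n
  (A *ᵥ v) i = sum (λ j → A i j * v j)

  IsEigenvector : ∀ {n} → Matrix n → Carrier → Vector Carrier n → Set ℓ
  IsEigenvector A μ v = ∀ i → (A *ᵥ v) i ≈ μ * v i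

  combination : ∀ {m n} → Vector Carrier m → (Fin m → Vector Carrier n) →
                Vector Carrier n
  combination a b i = sum (λ k → a k * b k i)

  -- The eigenspace {v | A v = μ v} has a basis of m vectors.  For real
  -- symmetric matrices, this is the multiplicity of μ in the multiset of
  -- eigenvalues; m = 0 means that μ is not an eigenvalue.
  record HasMultiplicity {n} (A : Matrix n) (μ : Carrier) (m : ℕ) :
         Set (c Level.⊔ ℓ) where
    field
      basis       : Fin m → Vector Carrier n
      eigen       : ∀ k → IsEigenvector A μ (basis k)
      independent : ∀ a → (∀ i → combination a basis i ≈ 0#) → ∀ k → a k ≈ 0#
      spanning    : ∀ v → IsEigenvector A μ v →
                    ∃[ a ] (∀ i → v i ≈ combination a basis i)

  SameEigenvalueMultiset : ∀ {n n′} → Matrix n → Matrix n′ → Set (c Level.⊔ ℓ)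
  SameEigenvalueMultiset A B =
    ∀ μ m → HasMultiplicity A μ m ⇔ HasMultiplicity B μ m

------------------------------------------------------------------------
-- Graphs

record Graph : Set where
  field
    order      : ℕ
    adj        : Fin order → Fin order → Bool
    adj-sym    : ∀ i j → adj i j ≡ adj j i
    adj-irrefl : ∀ i → adj i i ≡ false

  Vertex : Set
  Vertex = Fin order

  degree : Vertex → ℕ
  degree i = ∣ tabulate (adj i) ∣

open Graph public using (order; adj; Vertex; degree)

distanceGraph : (n : ℕ) (f : ℕ → Bool) → f 0 ≡ false → Graph
distanceGraph n f f0 = record
  { order      = n
  ; adj        = λ i j → f ∣ toℕ i - toℕ j ∣
  ; adj-sym    = λ i j → cong f (ℕ.∣-∣-comm (toℕ i) (toℕ j))
  ; adj-irrefl = λ i → trans (cong f (ℕ.∣n-n∣≡0 (toℕ i))) f0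
  }

-- P n, a path with n vertices.
P : ℕ → Graph
P n = distanceGraph n (λ d → d ≡ᵇ 1) refl

-- C n, the cycle of length n, for n ≥ 3; the test 1 <ᵇ d is then implied
-- by suc d ≡ᵇ n, and only prevents a loop when n = 1.
C : ℕ → Graph
C n = distanceGraph n (λ d → (d ≡ᵇ 1) ∨ ((1 <ᵇ d) ∧ (suc d ≡ᵇ n))) refl

module _ (G H : Graph) where

  private
    module G = Graph G
    module H = Graph H

  adj⊎ : G.Vertex ⊎ H.Vertex → G.Vertex ⊎ H.Vertex → Bool
  adj⊎ (inj₁ i) (inj₁ j) = G.adj i j
  adj⊎ (inj₂ i) (inj₂ j) = H.adj i j
  adj⊎ (inj₁ _) (inj₂ _) = false
  adj⊎ (inj₂ _) (inj₁ _) = false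

  adj⊎-sym : ∀ x y → adj⊎ x y ≡ adj⊎ y x
  adj⊎-sym (inj₁ i) (inj₁ j) = G.adj-sym i j
  adj⊎-sym (inj₂ i) (inj₂ j) = H.adj-sym i j
  adj⊎-sym (inj₁ _) (inj₂ _) = refl
  adj⊎-sym (inj₂ _) (inj₁ _) = refl

  adj⊎-irrefl : ∀ x → adj⊎ x x ≡ false
  adj⊎-irrefl (inj₁ i) = G.adj-irrefl i
  adj⊎-irrefl (inj₂ i) = H.adj-irrefl i

  infixl 6 _∪_

  -- Disjoint union.
  _∪_ : Graph
  _∪_ = record
    { order      = G.order ℕ.+ H.order
    ; adj        = λ i j → adj⊎ (splitAt G.order i) (splitAt G.order j)
    ; adj-sym    = λ i j → adj⊎-sym (splitAt G.order i) (splitAt G.order j)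
    ; adj-irrefl = λ i → adj⊎-irrefl (splitAt G.order i)
    }

------------------------------------------------------------------------
-- Spectrum

open Eigen ℝ-commutativeRing public

adjacencyMatrix : (G : Graph) → Matrix (order G)
adjacencyMatrix G i j = if adj G i j then 1ᴿ else 0ᴿ

SameSpectrum : Graph → Graph → Set
SameSpectrum G H = SameEigenvalueMultiset (adjacencyMatrix G) (adjacencyMatrix H)

------------------------------------------------------------------------
-- Bipartite graphs

IsBipartition : (G : Graph) → (Vertex G → Bool) → Set
IsBipartition G side = ∀ i j → adj G i j ≡ true → side i ≢ side j

RegularSide : (G : Graph) → (Vertex G → Bool) → Bool → Set
RegularSide G side s = ∃[ d ] (∀ i → side i ≡ s → degree G i ≡ d)

IsBiRegular : Graph → Set
IsBiRegular G = ∃[ side ] (IsBipartition G side × (∀ s → RegularSide G side s))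

-- By convention, half-regular graphs are not bi-regular.
IsHalfRegular : Graph → Set
IsHalfRegular G =
  (∃[ side ] (IsBipartition G side × ∃[ s ] RegularSide G side s)) ×
  ¬ IsBiRegular G

module Descending = Sort (Flip.decTotalOrder ℕ.≤-decTotalOrder)

degreeSequence : (G : Graph) → (Vertex G → Bool) → Bool → List ℕ
degreeSequence G side s =
  Descending.sort (map (degree G) (filter (λ i → side i Bool.≟ s) (allFin (order G))))

SameDegreeSequences : Graph → Graph → Set
SameDegreeSequences G H =
  ∃₂ λ sideG sideH → IsBipartition G sideG × IsBipartition H sideH ×
    (∀ s → degreeSequence G sideG s ≡ degreeSequence H sideH s)

------------------------------------------------------------------------
-- Cycles as subgraphs

-- Boolean vectors rather than functions, so that propositional equality
-- of subgraphs is equality of vertex sets and of edge sets.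
record Subgraph (n : ℕ) : Set where
  constructor mkSubgraph
  field
    vertices  : Subset n
    neighbors : Vec (Subset n) n

-- S is a subgraph of G isomorphic to H, i.e. the image of an embedding of
-- H in G.
record IsCopyOf (H G : Graph) (S : Subgraph (order G)) : Set where
  open Subgraph S
  field
    embed      : Vertex H → Vertex G
    injective  : Injective _≡_ _≡_ embed
    hom        : ∀ a b → adj H a b ≡ true → adj G (embed a) (embed b) ≡ true
    vertices⇔  : ∀ u → u ∈ vertices ⇔ (∃[ a ] embed a ≡ u)
    neighbors⇔ : ∀ u v → v ∈ lookup neighbors u ⇔
                 (∃₂ λ a b → embed a ≡ u × embed b ≡ v × adj H a b ≡ true)

IsCycle : (G : Graph) → ℕ → Subgraph (order G) → Set
IsCycle G ℓ S = 3 ℕ.≤ ℓ × IsCopyOf (C ℓ) G S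

HasGirth : Graph → ℕ → Set
HasGirth G g = (∃[ S ] IsCycle G g S) × (∀ ℓ S → IsCycle G ℓ S → g ℕ.≤ ℓ)

NumberOfCycles : Graph → ℕ → ℕ → Set
NumberOfCycles G ℓ c =
  ∃[ Ss ] (Unique Ss × (∀ S → S List.∈ Ss ⇔ IsCycle G ℓ S) × length Ss ≡ c)

DifferentNumbersOfCycles : Graph → Graph → ℕ → Set
DifferentNumbersOfCycles G H ℓ =
  ∃₂ λ c d → NumberOfCycles G ℓ c × NumberOfCycles H ℓ d × c ≢ d

{-# OPTIONS --safe #-}
module Submission where

-- Spectrum: on the cycle C 2m the folds f x - f (- x) and f (1 + x) - f (1 - x)
-- are vectors on the path P (m - 1), and both maps commute with the adjacency
-- operators.  A function annihilated by both has period 2, hence is determined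
-- by its sums over the even and over the odd vertices.  So the adjacency
-- operator of C 2m is similar to that of P (m - 1) ∪ P (m - 1) plus the operator
-- [[0,2],[2,0]], which does not depend on m, and C 2m ∪ P (n - 1) ∪ P (n - 1)
-- is symmetric in m and n up to similarity.  Similarity matters constructively:
-- it carries bases of eigenspaces over without deciding which real numbers are
-- eigenvalues.
--
-- Cycles: in a graph of maximum degree 2 the image of a cycle is closed under
-- adjacency, so it contains no vertex of degree 1 and fills a whole component.

open import Algebra.Bundles using (CommutativeRing; Semiring)
import Algebra.Properties.AbelianGroup as AbelianGroupProperties
import Algebra.Properties.Ring as RingProperties
import Algebra.Properties.Semiring.Mult as SemiringMult
import Algebra.Properties.Semiring.Sum as SemiringSum
import Algebra.Solver.Ring.NaturalCoefficients.Default as NaturalCoefficients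
open import Data.Bool.Base using (Bool; true; false; not; if_then_else_)
import Data.Bool.Properties as Bool
open import Data.Fin.Base
  using (Fin; zero; suc; toℕ; fromℕ; fromℕ<; inject₁; _↑ˡ_; _↑ʳ_; splitAt; join)
open import Data.Fin.Properties as Fin
  using (toℕ-injective; toℕ<n; toℕ-fromℕ; toℕ-fromℕ<; toℕ-inject₁;
         splitAt-↑ˡ; splitAt-↑ʳ; splitAt⁻¹-↑ˡ; splitAt⁻¹-↑ʳ; join-splitAt; splitAt-join)
open import Data.Nat.Base as ℕ using (ℕ; zero; suc; _≤_; _<_; z≤n; s≤s; _∸_)
open import Data.Nat.DivMod
  using (_%_; _mod_; m%n<n; m%n%n≡m%n; n%n≡0; [m+n]%n≡m%n; m<n⇒m%n≡m; %-distribˡ-+)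
import Data.Nat.Properties as ℕ
open import Data.Product.Base using (∃; ∃₂; _×_; _,_; proj₁; proj₂)
open import Data.Sum.Base using (_⊎_; inj₁; inj₂; [_,_]; [_,_]′; swap) renaming (map to map⊎)
open import Function.Base using (_∘_)
open import Function.Bundles using (_⇔_; mk⇔; Equivalence)
open import Level using (_⊔_)
open import Relation.Binary.PropositionalEquality as ≡ using (_≡_; _≢_)
open import Relation.Nullary using (¬_; Dec; yes; no; does; contradiction)
open import Defs using (module Eigen; Graph; Vertex; order; adj; adj⊎; _∪_; C; P)

-- A function on `C 2m` that is antisymmetric about the vertex 0 also vanishes at the antipode `m`;
-- what remains is a function on the `m - 1` vertices in between, with zero boundary values, which
-- is how a path arises. One reflection accounts for only `m - 1` of the `2m` dimensions, so a
-- second one, about the neighbouring vertex 1, is added; the composite of the two is the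
-- translation by 2. The lengths of the theorem are `m = 2k + 2` and `n = k′ + 1`. The work lies in
-- inverting the folds: a preimage of given path values comes from a recursion in steps of 2, and
-- correcting its two parity sums divides by `m`. Both path lengths are odd, so the two ends of a
-- path lie on the same side and the other side has all degrees 2. The added cycle has the length of
-- the shorter of the two original cycles: it makes the girths equal, while the longer length still
-- occurs in only one of the unions.

-- Neighbours of a vertex in a path and in a cycle.

module Neighbourhoods where

  open import Data.Bool.Properties using (T-≡; T-∨; T-∧)
  open import Data.Nat.Base using (_+_; ∣_-_∣; _≡ᵇ_; _<ᵇ_)
  open ≡

  -- A neighbourhood is given by naming its vertices, with a proof that there are no others. This
  -- form serves the adjacency operator, the degrees and the cycle embeddings alike.
  record OneNeighbour (G : Graph) (i p : Vertex G) : Set where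
    field
      adjacent : adj G i p ≡ true
      only     : ∀ j → adj G i j ≡ true → j ≡ p

  record TwoNeighbours (G : Graph) (i p q : Vertex G) : Set where
    field
      distinct  : p ≢ q
      adjacent₁ : adj G i p ≡ true
      adjacent₂ : adj G i q ≡ true
      only      : ∀ j → adj G i j ≡ true → j ≡ p ⊎ j ≡ q

  ∣n-1+n∣≡1 : ∀ n → ∣ n - suc n ∣ ≡ 1
  ∣n-1+n∣≡1 zero    = refl
  ∣n-1+n∣≡1 (suc n) = ∣n-1+n∣≡1 n

  ∣m-n∣≡1⇒ : ∀ m n → ∣ m - n ∣ ≡ 1 → suc m ≡ n ⊎ suc n ≡ m
  ∣m-n∣≡1⇒ zero    n       eq = inj₁ (sym eq)
  ∣m-n∣≡1⇒ (suc m) zero    eq = inj₂ (sym eq)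
  ∣m-n∣≡1⇒ (suc m) (suc n) eq = map⊎ (cong suc) (cong suc) (∣m-n∣≡1⇒ m n eq)

  -- Identifies the closing edge of a cycle. Two positive numbers up to `o` are no further apart
  -- than the larger of their predecessors, which is below `o`.
  ∣m-n∣≡o⇒ends : ∀ {m n o} → m ≤ o → n ≤ o → ∣ m - n ∣ ≡ o →
                 (m ≡ 0 × n ≡ o) ⊎ (m ≡ o × n ≡ 0)
  ∣m-n∣≡o⇒ends {zero}          _   _   eq = inj₁ (refl , eq)
  ∣m-n∣≡o⇒ends {suc m} {zero}  _   _   eq = inj₂ (eq , refl)
  ∣m-n∣≡o⇒ends {suc m} {suc n} {suc o} (s≤s m≤o) (s≤s n≤o) eq =
    contradiction (subst (_≤ o) eq (ℕ.≤-trans (ℕ.∣m-n∣≤m⊔n m n) (ℕ.⊔-lub m≤o n≤o)))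
                  ℕ.1+n≰n

  private
    ≡ᵇ⇒≡ : ∀ {m n} → (m ≡ᵇ n) ≡ true → m ≡ n
    ≡ᵇ⇒≡ {m} {n} = ℕ.≡ᵇ⇒≡ m n ∘ Equivalence.from T-≡

    ≡⇒≡ᵇ : ∀ {m n} → m ≡ n → (m ≡ᵇ n) ≡ true
    ≡⇒≡ᵇ {m} {n} = Equivalence.to T-≡ ∘ ℕ.≡⇒≡ᵇ m n

  module _ {n : ℕ} where

    P-adj : {i j : Fin n} → suc (toℕ i) ≡ toℕ j → adj (P n) i j ≡ true
    P-adj {i} eq rewrite sym eq | ∣n-1+n∣≡1 (toℕ i) = refl

    P-consecutive : {i j : Fin n} → suc (toℕ i) ≡ toℕ j ⊎ suc (toℕ j) ≡ toℕ i →
                    adj (P n) i j ≡ true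
    P-consecutive         (inj₁ i→j) = P-adj i→j
    P-consecutive {i} {j} (inj₂ j→i) = trans (Graph.adj-sym (P n) i j) (P-adj j→i)

    P-adj⁻ : {i j : Fin n} → adj (P n) i j ≡ true → suc (toℕ i) ≡ toℕ j ⊎ suc (toℕ j) ≡ toℕ i
    P-adj⁻ {i} {j} = ∣m-n∣≡1⇒ (toℕ i) (toℕ j) ∘ ≡ᵇ⇒≡

    P-inner : {p i q : Fin n} → suc (toℕ p) ≡ toℕ i → suc (toℕ i) ≡ toℕ q →
              TwoNeighbours (P n) i p q
    P-inner {p} {i} {q} p<i i<q = record
      { distinct  = λ { refl → ℕ.m≢1+m+n (toℕ p) {1} (begin
          toℕ p               ≡⟨ i<q ⟨
          suc (toℕ i)         ≡⟨ cong suc p<i ⟨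
          suc (suc (toℕ p))   ≡⟨ cong suc (ℕ.+-comm 1 (toℕ p)) ⟩
          suc (toℕ p + 1)     ∎) }
      ; adjacent₁ = trans (Graph.adj-sym (P n) i p) (P-adj p<i)
      ; adjacent₂ = P-adj i<q
      ; only      = λ j → map⊎ (λ e → toℕ-injective (ℕ.suc-injective (trans e (sym p<i))))
                               (λ e → toℕ-injective (trans (sym e) i<q)) ∘ swap ∘ P-adj⁻
      } where open ≡-Reasoning

  P-first : ∀ n → OneNeighbour (P (suc (suc n))) zero (suc zero)
  P-first n = record
    { adjacent = refl
    ; only     = only }
    where
    only : ∀ j → adj (P (suc (suc n))) zero j ≡ true → j ≡ suc zero
    only j 0~j with P-adj⁻ {i = zero} {j} 0~j
    ... | inj₁ e = toℕ-injective (sym e)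

  P-last : ∀ n → OneNeighbour (P (suc (suc n))) (fromℕ (suc n)) (inject₁ (fromℕ n))
  P-last n = record
    { adjacent = trans (Graph.adj-sym (P (2 + n)) (fromℕ (suc n)) (inject₁ (fromℕ n)))
                       (P-adj {i = inject₁ (fromℕ n)} (cong suc (toℕ-inject₁ (fromℕ n))))
    ; only     = only
    }
    where
    only : ∀ j → adj (P (suc (suc n))) (fromℕ (suc n)) j ≡ true → j ≡ inject₁ (fromℕ n)
    only j l~j with P-adj⁻ {i = fromℕ (suc n)} {j} l~j
    ... | inj₁ e = contradiction (toℕ<n j)
                     (ℕ.<⇒≱ (s≤s (ℕ.≤-reflexive (trans (cong suc (sym (toℕ-fromℕ (suc n)))) e))))
    ... | inj₂ e = toℕ-injective (trans (ℕ.suc-injective e) (sym (toℕ-inject₁ (fromℕ n))))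

  -- With at least two vertices, the ends are distinct and have a single neighbour each. An inner
  -- vertex brings along its neighbours, characterised by consecutive values, which avoids
  -- arithmetic on `Fin`.
  data PathVertex {n : ℕ} : Fin (suc (suc n)) → Set where
    first : PathVertex zero
    last  : PathVertex (fromℕ (suc n))
    inner : ∀ {i} (p q : Fin (suc (suc n))) → suc (toℕ p) ≡ toℕ i → suc (toℕ i) ≡ toℕ q →
            PathVertex i

  pathVertex : ∀ {n} (i : Fin (suc (suc n))) → PathVertex i
  pathVertex zero    = first
  pathVertex {n} (suc i) with toℕ i ℕ.≟ n
  ... | yes i≡n  = subst PathVertex (cong suc (toℕ-injective (trans (toℕ-fromℕ n) (sym i≡n)))) last
  ... | no  i≢n  = inner {i = suc i} (inject₁ i) (fromℕ< 2+i<2+n) (cong suc (toℕ-inject₁ i))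
                         (sym (toℕ-fromℕ< 2+i<2+n))
    where
    2+i<2+n : suc (suc (toℕ i)) < suc (suc n)
    2+i<2+n = s≤s (s≤s (ℕ.≤∧≢⇒< (ℕ.≤-pred (toℕ<n i)) i≢n))

  module _ {n : ℕ} where

    next prev : Fin (suc n) → Fin (suc n)
    next i = suc (toℕ i) mod suc n
    -- Adding `n` subtracts 1 modulo `suc n`, with no case distinction at zero.
    prev i = (toℕ i + n) mod suc n

    toℕ-mod : ∀ m → toℕ (m mod suc n) ≡ m % suc n
    toℕ-mod m = toℕ-fromℕ< (m%n<n m (suc n))

    C-adj : {i j : Fin (suc n)} → suc (toℕ i) ≡ toℕ j → adj (C (suc n)) i j ≡ true
    C-adj {i} eq rewrite sym eq | ∣n-1+n∣≡1 (toℕ i) = refl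

    C-consecutive : {i j : Fin (suc n)} → suc (toℕ i) ≡ toℕ j ⊎ suc (toℕ j) ≡ toℕ i →
                    adj (C (suc n)) i j ≡ true
    C-consecutive         (inj₁ i→j) = C-adj i→j
    C-consecutive {i} {j} (inj₂ j→i) = trans (Graph.adj-sym (C (suc n)) i j) (C-adj j→i)

    C-adj-ends : 1 < n → {i j : Fin (suc n)} → toℕ i ≡ n → toℕ j ≡ 0 →
                 adj (C (suc n)) i j ≡ true
    C-adj-ends 1<n {i} {j} i≡n j≡0 rewrite i≡n | j≡0 | ℕ.∣-∣-identityʳ n =
      Equivalence.to T-≡ (Equivalence.from (T-∨ {n ≡ᵇ 1})
        (inj₂ (Equivalence.from T-∧ (ℕ.<⇒<ᵇ 1<n , ℕ.≡⇒≡ᵇ n n refl))))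

    C-adj⁻ : {i j : Fin (suc n)} → adj (C (suc n)) i j ≡ true →
             (suc (toℕ i) ≡ toℕ j ⊎ suc (toℕ j) ≡ toℕ i) ⊎
             ((toℕ i ≡ 0 × toℕ j ≡ n) ⊎ (toℕ i ≡ n × toℕ j ≡ 0))
    C-adj⁻ {i} {j} i~j with Equivalence.to T-∨ (Equivalence.from T-≡ i~j)
    ... | inj₁ d = inj₁ (∣m-n∣≡1⇒ (toℕ i) (toℕ j) (ℕ.≡ᵇ⇒≡ _ 1 d))
    ... | inj₂ d = inj₂ (∣m-n∣≡o⇒ends (ℕ.≤-pred (toℕ<n i)) (ℕ.≤-pred (toℕ<n j))
                    (ℕ.≡ᵇ⇒≡ _ n (proj₂ (Equivalence.to (T-∧ {1 <ᵇ ∣ toℕ i - toℕ j ∣}) d))))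

    toℕ-next : ∀ i → (toℕ i < n × toℕ (next i) ≡ suc (toℕ i)) ⊎
                     (toℕ i ≡ n × toℕ (next i) ≡ 0)
    toℕ-next i with toℕ i ℕ.≟ n
    ... | yes i≡n = inj₂ (i≡n , trans (toℕ-mod (suc (toℕ i)))
                      (trans (cong (λ x → suc x % suc n) i≡n) (n%n≡0 (suc n))))
    ... | no  i≢n = inj₁ (i<n , trans (toℕ-mod (suc (toℕ i))) (m<n⇒m%n≡m (s≤s i<n)))
      where i<n = ℕ.≤∧≢⇒< (ℕ.≤-pred (toℕ<n i)) i≢n

    toℕ-prev : ∀ i → suc (toℕ (prev i)) ≡ toℕ i ⊎ (toℕ i ≡ 0 × toℕ (prev i) ≡ n)
    toℕ-prev zero    = inj₂ (refl , trans (toℕ-mod n) (m<n⇒m%n≡m (ℕ.n<1+n n)))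
    toℕ-prev (suc i) = inj₁ (cong suc (begin
      toℕ (prev (suc i))         ≡⟨ toℕ-mod (suc (toℕ i) + n) ⟩
      (suc (toℕ i) + n) % suc n  ≡⟨ cong (_% suc n) (ℕ.+-suc (toℕ i) n) ⟨
      (toℕ i + suc n) % suc n    ≡⟨ [m+n]%n≡m%n (toℕ i) (suc n) ⟩
      toℕ i % suc n              ≡⟨ m<n⇒m%n≡m (ℕ.m<n⇒m<1+n (toℕ<n i)) ⟩
      toℕ i                      ∎))
      where open ≡-Reasoning

    C-neighbours : 1 < n → ∀ i → TwoNeighbours (C (suc n)) i (prev i) (next i)
    C-neighbours 1<n i = record
      { distinct  = distinct
      ; adjacent₁ = adj-prev
      ; adjacent₂ = adj-next
      ; only      = λ j → only j ∘ C-adj⁻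
      }
      where
      adj-sym = Graph.adj-sym (C (suc n))

      adj-next : adj (C (suc n)) i (next i) ≡ true
      adj-next with toℕ-next i
      ... | inj₁ (_ , e) = C-adj (sym e)
      ... | inj₂ (e , e′) = C-adj-ends 1<n e e′

      adj-prev : adj (C (suc n)) i (prev i) ≡ true
      adj-prev with toℕ-prev i
      ... | inj₁ e = trans (adj-sym i (prev i)) (C-adj e)
      ... | inj₂ (e , e′) = trans (adj-sym i (prev i)) (C-adj-ends 1<n e′ e)

      -- Equality would close the cycle after at most two steps: depending on which of the two moves
      -- wraps around, it forces `x = x + 2`, `n = 1` or `n = 0`.
      distinct : prev i ≢ next i
      distinct p≡q with toℕ-prev i | toℕ-next i
      ... | inj₁ e | inj₁ (_ , e′) = ℕ.m≢1+m+n (toℕ (prev i)) {1} (begin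
        toℕ (prev i)             ≡⟨ trans (cong toℕ p≡q) e′ ⟩
        suc (toℕ i)              ≡⟨ cong suc e ⟨
        2 + toℕ (prev i)         ≡⟨ cong suc (ℕ.+-comm 1 (toℕ (prev i))) ⟩
        suc (toℕ (prev i) + 1)   ∎)
        where open ≡-Reasoning
      ... | inj₁ e | inj₂ (e₁ , e₂) = ℕ.<⇒≢ 1<n (begin
        1                     ≡⟨ cong suc (trans (cong toℕ p≡q) e₂) ⟨
        suc (toℕ (prev i))    ≡⟨ trans e e₁ ⟩
        n                     ∎)
        where open ≡-Reasoning
      ... | inj₂ (e₁ , e₂) | inj₁ (_ , e) = ℕ.<⇒≢ 1<n (begin
        1                     ≡⟨ cong suc e₁ ⟨
        suc (toℕ i)           ≡⟨ trans (cong toℕ p≡q) e ⟨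
        toℕ (prev i)          ≡⟨ e₂ ⟩
        n                     ∎)
        where open ≡-Reasoning
      ... | inj₂ (e₁ , _) | inj₂ (e₂ , _) =
        ℕ.<⇒≢ (ℕ.<-trans (s≤s z≤n) 1<n) (trans (sym e₁) e₂)

      only : ∀ j → (suc (toℕ i) ≡ toℕ j ⊎ suc (toℕ j) ≡ toℕ i) ⊎
                   ((toℕ i ≡ 0 × toℕ j ≡ n) ⊎ (toℕ i ≡ n × toℕ j ≡ 0)) →
             j ≡ prev i ⊎ j ≡ next i
      only j (inj₁ (inj₁ e)) with toℕ-next i
      ... | inj₁ (_ , e′) = inj₂ (toℕ-injective (trans (sym e) (sym e′)))
      ... | inj₂ (i≡n , _) = contradiction (toℕ<n j)
                               (ℕ.<⇒≱ (s≤s (ℕ.≤-reflexive (trans (cong suc (sym i≡n)) e))))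
      only j (inj₁ (inj₂ e)) with toℕ-prev i
      ... | inj₁ e′ = inj₁ (toℕ-injective (ℕ.suc-injective (trans e (sym e′))))
      ... | inj₂ (i≡0 , _) = contradiction (trans e i≡0) λ ()
      only j (inj₂ (inj₁ (e , e′))) with toℕ-prev i
      ... | inj₁ e″ = contradiction (trans e″ e) λ ()
      ... | inj₂ (_ , e″) = inj₁ (toℕ-injective (trans e′ (sym e″)))
      only j (inj₂ (inj₂ (e , e′))) with toℕ-next i
      ... | inj₁ (i<n , _) = contradiction e (ℕ.<⇒≢ i<n)
      ... | inj₂ (_ , e″) = inj₂ (toℕ-injective (trans e′ (sym e″)))

open Neighbourhoods

-- Sums over neighbourhoods.

module IndicatorSum {c ℓ} (R : Semiring c ℓ) where

  open Semiring R hiding (zero)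
  open SemiringSum R using (sum; sum-cong-≋; sum-replicate-zero)
  open import Relation.Binary.Reasoning.Setoid setoid

  indicator : Bool → Carrier
  indicator b = if b then 1# else 0#

  indicator-sum : ∀ {n} → (Fin n → Bool) → (Fin n → Carrier) → Carrier
  indicator-sum b v = sum (λ j → indicator (b j) * v j)

  private
    term-false : ∀ {b} x → b ≢ true → indicator b * x ≈ 0#
    term-false {false} x _   = zeroˡ x
    term-false {true}  x b≢t = contradiction ≡.refl b≢t

    term-true : ∀ {b} x → b ≡ true → indicator b * x ≈ x
    term-true x ≡.refl = *-identityˡ x

  indicator-sum-none : ∀ {n} (b : Fin n → Bool) v → (∀ j → b j ≢ true) → indicator-sum b v ≈ 0#
  indicator-sum-none {n} b v none =
    trans (sum-cong-≋ (λ j → term-false (v j) (none j))) (sum-replicate-zero n)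

  indicator-sum-one : ∀ {n} (b : Fin n → Bool) v {p} → b p ≡ true →
                      (∀ j → b j ≡ true → j ≡ p) → indicator-sum b v ≈ v p
  indicator-sum-one b v {zero} bp only = trans
    (+-cong (term-true (v zero) bp)
            (indicator-sum-none (b ∘ suc) (v ∘ suc) λ j bj → Fin.0≢1+n (≡.sym (only (suc j) bj))))
    (+-identityʳ _)
  indicator-sum-one b v {suc p} bp only = trans
    (+-cong (term-false (v zero) (λ b0 → Fin.0≢1+n (only zero b0)))
            (indicator-sum-one (b ∘ suc) (v ∘ suc) bp (λ j bj → Fin.suc-injective (only (suc j) bj))))
    (+-identityˡ _)

  indicator-sum-two : ∀ {n} (b : Fin n → Bool) v {p q} → p ≢ q → b p ≡ true → b q ≡ true →
                      (∀ j → b j ≡ true → j ≡ p ⊎ j ≡ q) → indicator-sum b v ≈ v p + v q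
  indicator-sum-two b v {zero} {zero} p≢q = contradiction ≡.refl p≢q
  indicator-sum-two b v {zero} {suc q} _ bp bq only =
    +-cong (term-true (v zero) bp) (indicator-sum-one (b ∘ suc) (v ∘ suc) bq only′)
    where
    only′ : ∀ j → b (suc j) ≡ true → j ≡ q
    only′ j bj with inj₂ e ← only (suc j) bj = Fin.suc-injective e
  indicator-sum-two b v {suc p} {zero} p≢q bp bq only = trans
    (indicator-sum-two b v (p≢q ∘ ≡.sym) bq bp (λ j bj → swap (only j bj)))
    (+-comm _ _)
  indicator-sum-two b v {suc p} {suc q} p≢q bp bq only = trans
    (+-cong (term-false (v zero) none)
            (indicator-sum-two (b ∘ suc) (v ∘ suc) (p≢q ∘ ≡.cong suc) bp bq
              (λ j bj → map⊎ Fin.suc-injective Fin.suc-injective (only (suc j) bj))))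
    (+-identityˡ _)
    where
    none : b zero ≢ true
    none b0 with only zero b0
    ... | inj₁ ()
    ... | inj₂ ()

  sum-↑ : ∀ m {n} (t : Fin (m ℕ.+ n) → Carrier) →
          sum t ≈ sum (λ i → t (i ↑ˡ n)) + sum (λ j → t (m ↑ʳ j))
  sum-↑ zero    t = sym (+-identityˡ _)
  sum-↑ (suc m) t = trans (+-congˡ (sum-↑ m (t ∘ suc))) (sym (+-assoc _ _ _))

  -- Over `ℝ` this unfolds to the adjacency matrix applied to `v`; over `ℕ`, at the constant 1, it
  -- counts neighbours. Hence the arbitrary semiring.
  neighbourSum : (G : Graph) → (Vertex G → Carrier) → Vertex G → Carrier
  neighbourSum G v i = indicator-sum (adj G i) v

  neighbourSum-one : ∀ {G i p} → OneNeighbour G i p → ∀ v → neighbourSum G v i ≈ v p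
  neighbourSum-one {G} {i} one v = indicator-sum-one (adj G i) v adjacent only
    where open OneNeighbour one

  neighbourSum-two : ∀ {G i p q} → TwoNeighbours G i p q → ∀ v → neighbourSum G v i ≈ v p + v q
  neighbourSum-two {G} {i} two v = indicator-sum-two (adj G i) v distinct adjacent₁ adjacent₂ only
    where open TwoNeighbours two

  module _ (G H : Graph) where

    private
      g = order G
      h = order H

      -- Keeping the value of `splitAt` at the row index as a variable `x` lets the off-diagonal
      -- block reduce to the constant `false` once `x` is known.
      row : ∀ v {i x} → splitAt g i ≡ x → neighbourSum (G ∪ H) v i ≈
            indicator-sum (λ j → adj⊎ G H x (inj₁ j)) (λ j → v (j ↑ˡ h)) +
            indicator-sum (λ j → adj⊎ G H x (inj₂ j)) (λ j → v (g ↑ʳ j))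
      row v {x = x} ≡.refl = trans (sum-↑ g _) (+-cong
        (sum-cong-≋ λ j → *-congʳ (reflexive (≡.cong (indicator ∘ adj⊎ G H x) (splitAt-↑ˡ g j h))))
        (sum-cong-≋ λ j → *-congʳ (reflexive (≡.cong (indicator ∘ adj⊎ G H x) (splitAt-↑ʳ g h j)))))

    neighbourSum-↑ˡ : ∀ v i → neighbourSum (G ∪ H) v (i ↑ˡ h) ≈ neighbourSum G (λ j → v (j ↑ˡ h)) i
    neighbourSum-↑ˡ v i = trans (row v (splitAt-↑ˡ g i h))
      (trans (+-congˡ (indicator-sum-none (λ (_ : Fin h) → false) _ λ _ ())) (+-identityʳ _))

    neighbourSum-↑ʳ : ∀ v j → neighbourSum (G ∪ H) v (g ↑ʳ j) ≈ neighbourSum H (λ j → v (g ↑ʳ j)) j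
    neighbourSum-↑ʳ v j = trans (row v (splitAt-↑ʳ g h j))
      (trans (+-congʳ (indicator-sum-none (λ (_ : Fin g) → false) _ λ _ ())) (+-identityˡ _))

-- Similarity of linear operators and multiplicities of eigenvalues.

module Similarity {c ℓ} (R : CommutativeRing c ℓ) where

  open CommutativeRing R hiding (zero)
  open SemiringSum semiring using (sum; sum-cong-≋)
  open IndicatorSum semiring
  open Eigen R
  open import Relation.Binary.Reasoning.Setoid setoid

  infix 4 _≋_

  _≋_ : {X : Set} → (X → Carrier) → (X → Carrier) → Set ℓ
  f ≋ g = ∀ x → f x ≈ g x

  -- Index sets are arbitrary types, so that direct sums are indexed by `X ⊎ Y` and reordering
  -- summands is a plain relabelling.
  Operator : Set → Set c
  Operator X = (X → Carrier) → X → Carrier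

  Congruent : {X : Set} → Operator X → Set _
  Congruent A = ∀ {v w} → v ≋ w → A v ≋ A w

  infix 4 _≅_

  -- Preimages are merely chosen, with no linearity demanded of the choice: injectivity already
  -- makes it the inverse linear map, as `≅-sym` shows.
  record _≅_ {X Y : Set} (A : Operator X) (B : Operator Y) : Set (c ⊔ ℓ) where
    field
      to          : (X → Carrier) → Y → Carrier
      to-cong     : ∀ {v w} → v ≋ w → to v ≋ to w
      to-+        : ∀ v w → to (λ x → v x + w x) ≋ (λ y → to v y + to w y)
      to-*        : ∀ a v → to (λ x → a * v x) ≋ (λ y → a * to v y)
      intertwines : ∀ v → to (A v) ≋ B (to v)
      injective   : ∀ {v w} → to v ≋ to w → v ≋ w
      surjective  : ∀ w → ∃ λ v → to v ≋ w

  open _≅_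

  ≅-relabel : {X Y : Set} {A : Operator X} {B : Operator Y} (f : Y → X) (g : X → Y) →
              (∀ x → f (g x) ≡ x) → (∀ y → g (f y) ≡ y) →
              (∀ v y → A v (f y) ≈ B (v ∘ f) y) → A ≅ B
  ≅-relabel f g fg gf A∘f = record
    { to          = _∘ f
    ; to-cong     = λ v≋w y → v≋w (f y)
    ; to-+        = λ _ _ _ → refl
    ; to-*        = λ _ _ _ → refl
    ; intertwines = A∘f
    ; injective   = λ {v} {w} vf≋wf x → ≡.subst (λ x → v x ≈ w x) (fg x) (vf≋wf (g x))
    ; surjective  = λ w → w ∘ g , λ y → reflexive (≡.cong w (gf y))
    }

  ≅-refl : {X : Set} {A : Operator X} → A ≅ A
  ≅-refl = ≅-relabel (λ x → x) (λ x → x) (λ _ → ≡.refl) (λ _ → ≡.refl) (λ _ _ → refl)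

  ≅-trans : {X Y Z : Set} {A : Operator X} {B : Operator Y} {D : Operator Z} →
            A ≅ B → B ≅ D → A ≅ D
  ≅-trans S T = record
    { to          = to T ∘ to S
    ; to-cong     = to-cong T ∘ to-cong S
    ; to-+        = λ v w z → trans (to-cong T (to-+ S v w) z) (to-+ T _ _ z)
    ; to-*        = λ a v z → trans (to-cong T (to-* S a v) z) (to-* T a _ z)
    ; intertwines = λ v z → trans (to-cong T (intertwines S v) z) (intertwines T _ z)
    ; injective   = injective S ∘ injective T
    ; surjective  = λ w → let u , Tu≋w = surjective T w ; v , Sv≋u = surjective S u
                          in v , λ z → trans (to-cong T Sv≋u z) (Tu≋w z)
    }

  -- Every law of the inverse is tested after applying `to S`, where it becomes a law of `S`.
  -- Congruence of `B` allows a vector under `B` to be replaced by the image of its chosen preimage.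
  ≅-sym : {X Y : Set} {A : Operator X} {B : Operator Y} → Congruent B → A ≅ B → B ≅ A
  ≅-sym {A = A} {B} B-cong S = record
    { to          = from
    ; to-cong     = λ v≋w → injective S λ y → trans (to-from _ y) (trans (v≋w y) (sym (to-from _ y)))
    ; to-+        = λ v w → injective S λ y → trans (to-from _ y)
                      (sym (trans (to-+ S _ _ y) (+-cong (to-from v y) (to-from w y))))
    ; to-*        = λ a v → injective S λ y → trans (to-from _ y)
                      (sym (trans (to-* S _ _ y) (*-congˡ (to-from v y))))
    ; intertwines = λ v → injective S λ y → trans (to-from _ y)
                      (sym (trans (intertwines S _ y) (B-cong (to-from v) y)))
    ; injective   = λ v≋w y → trans (sym (to-from _ y)) (trans (to-cong S v≋w y) (to-from _ y))
    ; surjective  = λ v → to S v , injective S (to-from _)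
    }
    where
    from = λ w → proj₁ (surjective S w)
    to-from = λ w → proj₂ (surjective S w)

  infixr 6 _⊕_

  _⊕_ : {X Y : Set} → Operator X → Operator Y → Operator (X ⊎ Y)
  (A ⊕ B) v (inj₁ x) = A (λ x → v (inj₁ x)) x
  (A ⊕ B) v (inj₂ y) = B (λ y → v (inj₂ y)) y

  ⊕-congruent : {X Y : Set} {A : Operator X} {B : Operator Y} →
                Congruent A → Congruent B → Congruent (A ⊕ B)
  ⊕-congruent A-cong B-cong v≋w (inj₁ x) = A-cong (v≋w ∘ inj₁) x
  ⊕-congruent A-cong B-cong v≋w (inj₂ y) = B-cong (v≋w ∘ inj₂) y

  ⊕-cong : {X X′ Y Y′ : Set} {A : Operator X} {A′ : Operator X′}
           {B : Operator Y} {B′ : Operator Y′} →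
           A ≅ A′ → B ≅ B′ → A ⊕ B ≅ A′ ⊕ B′
  ⊕-cong S T = record
    { to          = λ v → [ to S (v ∘ inj₁) , to T (v ∘ inj₂) ]
    ; to-cong     = λ v≋w → λ where
        (inj₁ x) → to-cong S (v≋w ∘ inj₁) x
        (inj₂ y) → to-cong T (v≋w ∘ inj₂) y
    ; to-+        = λ v w → λ { (inj₁ x) → to-+ S _ _ x ; (inj₂ y) → to-+ T _ _ y }
    ; to-*        = λ a v → λ { (inj₁ x) → to-* S _ _ x ; (inj₂ y) → to-* T _ _ y }
    ; intertwines = λ v → λ { (inj₁ x) → intertwines S _ x ; (inj₂ y) → intertwines T _ y }
    ; injective   = λ v≋w → λ where
        (inj₁ x) → injective S (v≋w ∘ inj₁) x
        (inj₂ y) → injective T (v≋w ∘ inj₂) y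
    ; surjective  = λ w → let v , Sv≋w = surjective S (w ∘ inj₁) ; v′ , Tv′≋w = surjective T (w ∘ inj₂)
                          in [ v , v′ ] , λ { (inj₁ x) → Sv≋w x ; (inj₂ y) → Tv′≋w y }
    }

  *ᵥ-congruent : ∀ {n} (A : Matrix n) → Congruent (A *ᵥ_)
  *ᵥ-congruent A v≋w i = sum-cong-≋ (λ j → *-congˡ (v≋w j))

  module _ {X Y : Set} {A : Operator X} {B : Operator Y} (S : A ≅ B) where

    to-0 : to S (λ _ → 0#) ≋ (λ _ → 0#)
    to-0 y = trans (to-cong S (λ _ → sym (zeroˡ 0#)) y) (trans (to-* S 0# (λ _ → 0#) y) (zeroˡ _))

    to-combination : ∀ {m} (a : Fin m → Carrier) (b : Fin m → X → Carrier) →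
                     to S (λ x → sum (λ k → a k * b k x)) ≋ (λ y → sum (λ k → a k * to S (b k) y))
    to-combination {zero}  a b y = to-0 y
    to-combination {suc m} a b y = trans (to-+ S _ _ y)
      (+-cong (to-* S _ _ y) (to-combination (a ∘ suc) (b ∘ suc) y))

  -- Coefficients are kept. A vanishing combination of images is pulled back by injectivity, and so
  -- is the eigenvalue equation for a preimage of an eigenvector.
  transfer : ∀ {n n′} {A : Matrix n} {B : Matrix n′} → (A *ᵥ_) ≅ (B *ᵥ_) →
             ∀ {μ m} → HasMultiplicity A μ m → HasMultiplicity B μ m
  transfer {A = A} {B} S {μ} M = record
    { basis       = λ k → to S (basis k)
    ; eigen       = λ k i → trans (sym (intertwines S (basis k) i))
                      (trans (to-cong S (eigen k) i) (to-* S _ _ i))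
    ; independent = λ a comb≈0 → independent a (injective S λ i →
                      trans (to-combination S a basis i) (trans (comb≈0 i) (sym (to-0 S i))))
    ; spanning    = λ w Bw≈μw →
        let v , Sv≋w = surjective S w
            a , v≋ab = spanning v (injective S λ i → begin
              to S (A *ᵥ v) i          ≈⟨ intertwines S v i ⟩
              (B *ᵥ to S v) i          ≈⟨ *ᵥ-congruent B Sv≋w i ⟩
              (B *ᵥ w) i               ≈⟨ Bw≈μw i ⟩
              μ * w i                  ≈⟨ *-congˡ (Sv≋w i) ⟨
              μ * to S v i             ≈⟨ to-* S μ v i ⟨
              to S (λ j → μ * v j) i   ∎)
        in a , λ i → trans (sym (Sv≋w i)) (trans (to-cong S v≋ab i) (to-combination S a basis i))
    }
    where open HasMultiplicity M

  ≅⇒sameEigenvalueMultiset : ∀ {n n′} {A : Matrix n} {B : Matrix n′} → (A *ᵥ_) ≅ (B *ᵥ_) →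
                             SameEigenvalueMultiset A B
  ≅⇒sameEigenvalueMultiset {B = B} S μ m = mk⇔ (transfer S) (transfer (≅-sym (*ᵥ-congruent B) S))

  ∪-≅-⊕ : ∀ G H → neighbourSum (G ∪ H) ≅ neighbourSum G ⊕ neighbourSum H
  ∪-≅-⊕ G H = ≅-relabel (join g h) (splitAt g) (join-splitAt g h) (splitAt-join g h)
    λ { v (inj₁ i) → neighbourSum-↑ˡ G H v i ; v (inj₂ j) → neighbourSum-↑ʳ G H v j }
    where
    g = order G
    h = order H

-- Splitting an even cycle into two paths and its parity classes.

-- Makes the ring a ℚ-algebra. The division is by `m`: a function of period 2 on a cycle of length
-- `m + m` is recovered from its sums over the `m` vertices of each parity.
HasInverses : ∀ {c ℓ} → CommutativeRing c ℓ → Set (c ⊔ ℓ)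
HasInverses R = ∀ n → ∃ λ r → r * (suc n · 1#) ≈ 1#
  where
  open CommutativeRing R
  open SemiringMult semiring using () renaming (_×_ to _·_)

module Decomposition {c ℓ} (R : CommutativeRing c ℓ) (inverse : HasInverses R) where

  open CommutativeRing R hiding (zero)
  open SemiringMult semiring using (×-assoc-*; ×-congʳ) renaming (_×_ to _·_)
  open AbelianGroupProperties +-abelianGroup
  open RingProperties ring using (x[y-z]≈xy-xz; -1*x≈-x)
  open NaturalCoefficients commutativeSemiring using (solve; _:=_; _:+_; _:*_)
  open IndicatorSum semiring
  open Similarity R
  open Eigen R using (SameEigenvalueMultiset)
  open import Relation.Binary.Reasoning.Setoid setoid

  Sequence : Set c
  Sequence = ℕ → Carrier

  a+b-[c+d] : ∀ a b c d → (a + b) - (c + d) ≈ (a - c) + (b - d)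
  a+b-[c+d] a b c d = trans (+-congˡ (sym (⁻¹-∙-comm c d)))
    (solve 4 (λ a b c d → (a :+ b) :+ (c :+ d) := (a :+ c) :+ (b :+ d)) refl a b (- c) (- d))

  a-[a-b]≈b : ∀ a b → a - (a - b) ≈ b
  a-[a-b]≈b a b = begin
    a - (a - b)        ≈⟨ +-congˡ (⁻¹-anti-homo‿- a b) ⟩
    a + (b - a)        ≈⟨ +-assoc a b (- a) ⟨
    a + b - a          ≈⟨ xyx⁻¹≈y a b ⟩
    b                  ∎

  a+[b-a]≈b : ∀ a b → a + (b - a) ≈ b
  a+[b-a]≈b a b = trans (sym (+-assoc a b (- a))) (xyx⁻¹≈y a b)

  a-0≈a : ∀ a → a - 0# ≈ a
  a-0≈a a = trans (+-congˡ ε⁻¹≈ε) (+-identityʳ a)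

  divide : ∀ n s → ∃ λ t → suc n · t ≈ s
  divide n s = s * r , (begin
    suc n · (s * r)          ≈⟨ ×-congʳ (suc n) (*-identityˡ _) ⟨
    suc n · (1# * (s * r))   ≈⟨ ×-assoc-* (suc n) 1# (s * r) ⟨
    (suc n · 1#) * (s * r)   ≈⟨ solve 3 (λ a b c → a :* (b :* c) := (c :* a) :* b) refl (suc n · 1#) s r ⟩
    (r * (suc n · 1#)) * s   ≈⟨ *-congʳ r-inverse ⟩
    1# * s                   ≈⟨ *-identityˡ s ⟩
    s                        ∎)
    where
    r = proj₁ (inverse n)
    r-inverse = proj₂ (inverse n)

  torsion-free : ∀ n {t} → suc n · t ≈ 0# → t ≈ 0#
  torsion-free n {t} nt≈0 = begin
    t                        ≈⟨ *-identityˡ t ⟨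
    1# * t                   ≈⟨ *-congʳ r-inverse ⟨
    (r * (suc n · 1#)) * t   ≈⟨ *-assoc r (suc n · 1#) t ⟩
    r * ((suc n · 1#) * t)   ≈⟨ *-congˡ (×-assoc-* (suc n) 1# t) ⟩
    r * (suc n · (1# * t))   ≈⟨ *-congˡ (×-congʳ (suc n) (*-identityˡ t)) ⟩
    r * (suc n · t)          ≈⟨ *-congˡ nt≈0 ⟩
    r * 0#                   ≈⟨ zeroʳ r ⟩
    0#                       ∎
    where
    r = proj₁ (inverse n)
    r-inverse = proj₂ (inverse n)

  -- Functions on a cycle as periodic sequences

  mod-cong : ∀ {n} x y → x % suc n ≡ y % suc n → x mod suc n ≡ y mod suc n
  mod-cong x y eq = toℕ-injective (≡.trans (toℕ-mod x) (≡.trans eq (≡.sym (toℕ-mod y))))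

  [m%n+o]%n≡[m+o]%n : ∀ m o n → (m % suc n ℕ.+ o) % suc n ≡ (m ℕ.+ o) % suc n
  [m%n+o]%n≡[m+o]%n m o n = ≡.trans (%-distribˡ-+ (m % suc n) o (suc n))
    (≡.trans (≡.cong (λ x → (x ℕ.+ o % suc n) % suc n) (m%n%n≡m%n m (suc n)))
             (≡.sym (%-distribˡ-+ m o (suc n))))

  unroll : ∀ {n} → (Fin (suc n) → Carrier) → Sequence
  unroll {n} v x = v (x mod suc n)

  unroll-toℕ : ∀ {n} (v : Fin (suc n) → Carrier) i → unroll v (toℕ i) ≡ v i
  unroll-toℕ v i = ≡.cong v (toℕ-injective (≡.trans (toℕ-mod (toℕ i)) (m<n⇒m%n≡m (toℕ<n i))))

  unroll-periodic : ∀ {n} (v : Fin (suc n) → Carrier) x → unroll v (suc n ℕ.+ x) ≡ unroll v x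
  unroll-periodic {n} v x = ≡.cong v (mod-cong (suc n ℕ.+ x) x
    (≡.trans (≡.cong (_% suc n) (ℕ.+-comm (suc n) x)) ([m+n]%n≡m%n x (suc n))))

  unroll-sample : ∀ {n} (f : Sequence) {x} → x < suc n → unroll {n} (f ∘ toℕ) x ≡ f x
  unroll-sample {n} f {x} x<N = ≡.cong f (≡.trans (toℕ-mod x) (m<n⇒m%n≡m x<N))

  -- Centred at `suc x`, so that the predecessor is the plain index `x` and no subtraction enters.
  neighbourSum-C : ∀ {n} → 1 < n → (v : Fin (suc n) → Carrier) → ∀ x →
                unroll (neighbourSum (C (suc n)) v) (suc x) ≈ unroll v x + unroll v (suc (suc x))
  neighbourSum-C {n} 1<n v x = trans
    (neighbourSum-two (C-neighbours 1<n i) v)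
    (reflexive (≡.cong₂ _+_ (≡.cong v (mod-cong (toℕ i ℕ.+ n) x prev≡))
        (≡.cong v (mod-cong (suc (toℕ i)) (suc (suc x)) next≡))))
    where
    i = suc x mod suc n
    prev≡ : (toℕ i ℕ.+ n) % suc n ≡ x % suc n
    prev≡ = ≡.trans (≡.cong (λ y → (y ℕ.+ n) % suc n) (toℕ-mod {n} (suc x)))
      (≡.trans ([m%n+o]%n≡[m+o]%n (suc x) n n)
      (≡.trans (≡.cong (_% suc n) (≡.sym (ℕ.+-suc x n))) ([m+n]%n≡m%n x (suc n))))
    next≡ : suc (toℕ i) % suc n ≡ suc (suc x) % suc n
    next≡ = ≡.trans (≡.cong (_% suc n) (≡.trans (≡.cong suc (toℕ-mod {n} (suc x))) (ℕ.+-comm 1 _)))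
      (≡.trans ([m%n+o]%n≡[m+o]%n (suc x) 1 n) (≡.cong (_% suc n) (ℕ.+-comm (suc x) 1)))

  -- Functions on a path as sequences that vanish at both ends

  extend : ∀ {n} → (Fin n → Carrier) → Sequence
  extend {zero}  v x       = 0#
  extend {suc n} v zero    = v zero
  extend {suc n} v (suc x) = extend (v ∘ suc) x

  extend-toℕ : ∀ {n} (v : Fin n → Carrier) i → extend v (toℕ i) ≡ v i
  extend-toℕ v zero    = ≡.refl
  extend-toℕ v (suc i) = extend-toℕ (v ∘ suc) i

  extend-≥ : ∀ {n} (v : Fin n → Carrier) {x} → n ≤ x → extend v x ≡ 0#
  extend-≥ {zero}  v n≤x       = ≡.refl
  extend-≥ {suc n} v (s≤s n≤x) = extend-≥ (v ∘ suc) n≤x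

  extend-sample : ∀ {n} (f : Sequence) {x} → x < n → extend {n} (f ∘ toℕ) x ≡ f x
  extend-sample f {zero}  (s≤s _)   = ≡.refl
  extend-sample f {suc x} (s≤s x<n) = extend-sample (f ∘ suc) x<n

  extend-0 : ∀ {n} {v : Fin n → Carrier} → (∀ i → v i ≈ 0#) → ∀ x → extend v x ≈ 0#
  extend-0 {zero}  v≈0 x       = refl
  extend-0 {suc n} v≈0 zero    = v≈0 zero
  extend-0 {suc n} v≈0 (suc x) = extend-0 (v≈0 ∘ suc) x

  -- Vertex `i` moves to position `suc i`, which leaves a zero at 0 as well as beyond the last
  -- vertex. With these boundary values the ends of a path obey the same two-term formula as its
  -- inner vertices.
  pad : ∀ {n} → (Fin n → Carrier) → Sequence
  pad v zero    = 0#
  pad v (suc x) = extend v x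

  neighbourSum-P : ∀ {n} (v : Fin (suc (suc n)) → Carrier) i →
                neighbourSum (P (suc (suc n))) v i ≈ pad v (toℕ i) + pad v (suc (suc (toℕ i)))
  neighbourSum-P {n} v i with pathVertex i
  ... | first = trans (neighbourSum-one (P-first n) v) (sym (+-identityˡ _))
  ... | last = trans (neighbourSum-one (P-last n) v) (begin
    v (inject₁ (fromℕ n))                       ≡⟨ extend-toℕ v (inject₁ (fromℕ n)) ⟨
    extend v (toℕ (inject₁ (fromℕ n)))          ≡⟨ ≡.cong (extend v) (toℕ-inject₁ (fromℕ n)) ⟩
    extend v m                                  ≈⟨ +-identityʳ _ ⟨
    extend v m + 0#                             ≡⟨ ≡.cong (extend v m +_) (extend-≥ v 2+n≤2+m) ⟨
    extend v m + extend v (suc (suc m))         ∎)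
    where
    m = toℕ (fromℕ n)
    2+n≤2+m = s≤s (s≤s (ℕ.≤-reflexive (≡.sym (toℕ-fromℕ n))))
  ... | inner p q p→i i→q = trans (neighbourSum-two (P-inner p→i i→q) v) (reflexive
      (≡.cong₂ _+_ (≡.trans (≡.sym (extend-toℕ v p)) (≡.cong (pad v) p→i))
                   (≡.trans (≡.sym (extend-toℕ v q)) (≡.cong (extend v) (≡.sym i→q)))))

  -- With `m` terms the sum goes once around a cycle of length `m + m`; odd positions are reached by
  -- shifting the sequence.
  evenSum : ℕ → Sequence → Carrier
  evenSum zero    f = 0#
  evenSum (suc m) f = f 0 + evenSum m (λ x → f (suc (suc x)))

  private
    2+<suc+suc : ∀ {m x} → x < m ℕ.+ m → suc (suc x) < suc m ℕ.+ suc m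
    2+<suc+suc {m} {x} x<2m = s≤s (≡.subst (suc x <_) (≡.sym (ℕ.+-suc m m)) (s≤s x<2m))

  evenSum-cong : ∀ m {f g} → (∀ x → x < m ℕ.+ m → f x ≈ g x) → evenSum m f ≈ evenSum m g
  evenSum-cong zero    f≈g = refl
  evenSum-cong (suc m) f≈g = +-cong (f≈g 0 (s≤s z≤n))
      (evenSum-cong m (λ x → f≈g (suc (suc x)) ∘ 2+<suc+suc))

  evenSum-+ : ∀ m f g → evenSum m (λ x → f x + g x) ≈ evenSum m f + evenSum m g
  evenSum-+ zero    f g = sym (+-identityˡ 0#)
  evenSum-+ (suc m) f g = trans (+-congˡ (evenSum-+ m _ _))
    (solve 4 (λ a b c d → (a :+ b) :+ (c :+ d) := (a :+ c) :+ (b :+ d)) refl _ _ _ _)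

  evenSum-* : ∀ m a f → evenSum m (λ x → a * f x) ≈ a * evenSum m f
  evenSum-* zero    a f = sym (zeroʳ a)
  evenSum-* (suc m) a f = trans (+-congˡ (evenSum-* m a _)) (sym (distribˡ a _ _))

  evenSum-const : ∀ m f → (∀ x → x < m ℕ.+ m → f (suc (suc x)) ≈ f x) → evenSum m f ≈ m · f 0
  evenSum-const zero    f f∘2+≈f = refl
  evenSum-const (suc m) f f∘2+≈f = +-congˡ (trans
    (evenSum-const m _ λ x → f∘2+≈f (suc (suc x)) ∘ 2+<suc+suc)
    (×-congʳ m (f∘2+≈f 0 (s≤s z≤n))))

  -- The shift trades the term `f 0` for `f (m + m)`. The sums are compared with `f 0` added to
  -- both, which keeps the telescoping free of negatives.
  evenSum-shift : ∀ m f → f (m ℕ.+ m) ≈ f 0 → evenSum m (λ x → f (suc (suc x))) ≈ evenSum m f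
  evenSum-shift m f f2m≈f0 = ∙-cancelˡ (f 0) _ _ (begin
    f 0 + evenSum m (λ x → f (suc (suc x)))   ≈⟨ telescope m f ⟩
    evenSum m f + f (m ℕ.+ m)                 ≈⟨ +-comm _ _ ⟩
    f (m ℕ.+ m) + evenSum m f                 ≈⟨ +-congʳ f2m≈f0 ⟩
    f 0 + evenSum m f                         ∎)
    where
    telescope : ∀ m f → f 0 + evenSum m (λ x → f (suc (suc x))) ≈ evenSum m f + f (m ℕ.+ m)
    telescope zero    f = +-comm _ _
    telescope (suc m) f = begin
      f 0 + evenSum (suc m) (λ x → f (suc (suc x)))                  ≈⟨ +-congˡ (telescope m _) ⟩
      f 0 + (evenSum m (λ x → f (suc (suc x))) + f (2 ℕ.+ (m ℕ.+ m))) ≈⟨ +-assoc _ _ _ ⟨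
      evenSum (suc m) f + f (2 ℕ.+ (m ℕ.+ m))                        ≡⟨ ≡.cong (λ x → evenSum (suc m) f + f
          (suc x)) (ℕ.+-suc m m) ⟨
      evenSum (suc m) f + f (suc m ℕ.+ suc m)                        ∎

  -- Folding a sequence of period N about 0

  module Folding (p : ℕ) where

    private
      m = suc p
      N = m ℕ.+ m

    m≤N : m ≤ N
    m≤N = ℕ.m≤m+n m m

    N∸m≡m : N ∸ m ≡ m
    N∸m≡m = ℕ.m+n∸m≡n m m

    1+[N∸1+x]≡N∸x : ∀ {x} → x < N → suc (N ∸ suc x) ≡ N ∸ x
    1+[N∸1+x]≡N∸x x<N = ≡.sym (ℕ.+-∸-assoc 1 x<N)

    -- For `x` up to `N`, the index `N ∸ x` represents `- x`; up to a factor 2 this is the part of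
    -- `f` antisymmetric about 0.
    fold : Sequence → Sequence
    fold f x = f x - f (N ∸ x)

    fold-cong : ∀ {f g} → (∀ x → f x ≈ g x) → ∀ x → fold f x ≈ fold g x
    fold-cong f≈g x = +-cong (f≈g x) (-‿cong (f≈g (N ∸ x)))

    fold-+ : ∀ f g x → fold (λ x → f x + g x) x ≈ fold f x + fold g x
    fold-+ f g x = a+b-[c+d] (f x) (g x) (f (N ∸ x)) (g (N ∸ x))

    fold-* : ∀ a f x → fold (λ x → a * f x) x ≈ a * fold f x
    fold-* a f x = sym (x[y-z]≈xy-xz a (f x) (f (N ∸ x)))

    -- The reflection is an automorphism of the cycle: the neighbours of `suc x` go to those of its
    -- mirror vertex, with predecessor and successor exchanged.
    fold-step : ∀ f g → (∀ x → g (suc x) ≈ f x + f (suc (suc x))) → ∀ {x} → suc x < N →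
                fold g (suc x) ≈ fold f x + fold f (suc (suc x))
    fold-step f g g≈f+f {x} 1+x<N = begin
      g (suc x) - g (N ∸ suc x)
        ≡⟨ ≡.cong (λ y → g (suc x) - g y) (1+[N∸1+x]≡N∸x 1+x<N) ⟨
      g (suc x) - g (suc y)
        ≈⟨ +-cong (g≈f+f x) (-‿cong (trans (g≈f+f y) (+-comm _ _))) ⟩
      (f x + f (suc (suc x))) - (f (suc (suc y)) + f y)
        ≡⟨ ≡.cong (λ z → (f x + f (suc (suc x))) - (f z + f y))
             (≡.trans (≡.cong suc (1+[N∸1+x]≡N∸x 1+x<N)) (1+[N∸1+x]≡N∸x (ℕ.<-trans (ℕ.n<1+n x) 1+x<N))) ⟩
      (f x + f (suc (suc x))) - (f (N ∸ x) + f y)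
        ≈⟨ a+b-[c+d] _ _ _ _ ⟩
      fold f x + fold f (suc (suc x)) ∎
      where y = N ∸ suc (suc x)

    folded : Sequence → Fin p → Carrier
    folded f i = fold f (suc (toℕ i))

    -- The reason that the fold lives on a path: it vanishes at 0 by periodicity and at the antipode
    -- `m` because `N ∸ m` is `m`. These are the zeros that `pad` puts around the `p` vertices in
    -- between.
    pad-folded : ∀ f → f N ≈ f 0 → ∀ {x} → x ≤ m → pad (folded f) x ≈ fold f x
    pad-folded f fN≈f0 {zero}  _ = sym (x≈y⇒x∙y⁻¹≈ε (sym fN≈f0))
    pad-folded f fN≈f0 {suc x} (s≤s x≤p) with x ℕ.≟ p
    ... | no  x≢p    = reflexive (extend-sample (λ x → fold f (suc x)) (ℕ.≤∧≢⇒< x≤p x≢p))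
    ... | yes ≡.refl = begin
      extend (folded f) p    ≡⟨ extend-≥ (folded f) ℕ.≤-refl ⟩
      0#                     ≈⟨ -‿inverseʳ (f m) ⟨
      f m - f m              ≡⟨ ≡.cong (λ x → f m - f x) N∸m≡m ⟨
      fold f m               ∎

    pad-0 : ∀ {n} {v : Fin n → Carrier} → (∀ i → v i ≈ 0#) → ∀ x → pad v x ≈ 0#
    pad-0 v≈0 zero    = refl
    pad-0 v≈0 (suc x) = extend-0 v≈0 x

    -- The folded values only speak about positions up to `m`; a position beyond `m` is the mirror
    -- image of one that they cover.
    folded-0⇒symmetric : ∀ f → f N ≈ f 0 → (∀ i → folded f i ≈ 0#) → ∀ {x} → x ≤ N → f x ≈ f (N ∸ x)
    folded-0⇒symmetric f fN≈f0 f≈0 {x} x≤N with ℕ.≤-total x m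
    ... | inj₁ x≤m = x∙y⁻¹≈ε⇒x≈y _ _ (trans (sym (pad-folded f fN≈f0 x≤m)) (pad-0 f≈0 x))
    ... | inj₂ m≤x = sym (begin
      f (N ∸ x)                ≈⟨ x∙y⁻¹≈ε⇒x≈y _ _ (trans (sym (pad-folded f fN≈f0 N∸x≤m))
          (pad-0 f≈0 (N ∸ x))) ⟩
      f (N ∸ (N ∸ x))          ≡⟨ ≡.cong f (ℕ.m∸[m∸n]≡n x≤N) ⟩
      f x                      ∎)
      where
      N∸x≤m : N ∸ x ≤ m
      N∸x≤m = ≡.subst (N ∸ x ≤_) N∸m≡m (ℕ.∸-monoʳ-≤ N m≤x)

    -- A sequence that is even about 0 and about 1 has period 2.
    two-periodic : ∀ f → f N ≈ f 0 → f (suc N) ≈ f 1 →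
                   (∀ i → folded f i ≈ 0#) → (∀ i → folded (λ x → f (suc x)) i ≈ 0#) →
                   ∀ {x} → x < N → f (suc (suc x)) ≈ f x
    two-periodic f fN≈f0 f1+N≈f1 even₀ even₁ {x} x<N = begin
      f (suc (suc x))          ≈⟨ folded-0⇒symmetric (λ x → f (suc x)) f1+N≈f1 even₁ x<N ⟩
      f (suc (N ∸ suc x))      ≡⟨ ≡.cong f (1+[N∸1+x]≡N∸x x<N) ⟩
      f (N ∸ x)                ≈⟨ folded-0⇒symmetric f fN≈f0 even₀ (ℕ.<⇒≤ x<N) ⟨
      f x                      ∎

    alternating : Carrier → Carrier → Sequence
    alternating a b zero          = a
    alternating a b (suc zero)    = b
    alternating a b (suc (suc x)) = alternating a b x

    -- An even sum means equal parity. Leaving `k` free covers both reflections: mirror positions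
    -- add up to `m + m` for the one about 0 and to `suc m + suc m` for the one about 1.
    alternating-symmetric : ∀ a b k {x y} → x ℕ.+ y ≡ k ℕ.+ k →
                            alternating a b x ≡ alternating a b y
    alternating-symmetric a b zero    {zero} {zero} eq = ≡.refl
    alternating-symmetric a b (suc k) {zero} {suc zero} eq =
      contradiction (ℕ.suc-injective eq) (ℕ.<⇒≢ (≡.subst (0 <_) (≡.sym (ℕ.+-suc k k)) (s≤s z≤n)))
    alternating-symmetric a b (suc k) {zero} {suc (suc y)} eq =
      alternating-symmetric a b k {zero} {y}
        (ℕ.suc-injective (≡.trans (ℕ.suc-injective eq) (ℕ.+-suc k k)))
    alternating-symmetric a b (suc k) {suc zero} {zero} eq =
      contradiction (ℕ.suc-injective eq) (ℕ.<⇒≢ (≡.subst (0 <_) (≡.sym (ℕ.+-suc k k)) (s≤s z≤n)))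
    alternating-symmetric a b (suc k) {suc zero} {suc zero} eq = ≡.refl
    alternating-symmetric a b (suc k) {suc zero} {suc (suc y)} eq =
      alternating-symmetric a b k {suc zero} {y}
        (ℕ.suc-injective (≡.trans (ℕ.suc-injective eq) (ℕ.+-suc k k)))
    alternating-symmetric a b (suc k) {suc (suc x)} {y} eq =
      alternating-symmetric a b k {x} {y} (ℕ.suc-injective (≡.trans (ℕ.suc-injective eq) (ℕ.+-suc k k)))

    -- Solves f (2 + x) - f (- x) = w (suc x) and f x - f (- x) = u x for f.
    unfold⁺ : (u w : Sequence) → Sequence
    unfold⁺ u w zero          = 0#
    unfold⁺ u w (suc zero)    = 0#
    unfold⁺ u w (suc (suc x)) = (unfold⁺ u w x - u x) + w (suc x)

    -- The recursion is followed only halfway round; in the upper half the value is forced by the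
    -- fold about 0. The two prescriptions meet at `m`, where they agree if `u m` is zero.
    unfold : (u w : Sequence) → Sequence
    unfold u w x with x ℕ.≤? m
    ... | yes _ = unfold⁺ u w x
    ... | no  _ = unfold⁺ u w (N ∸ x) - u (N ∸ x)

    unfold-low : ∀ u w {x} → x ≤ m → unfold u w x ≡ unfold⁺ u w x
    unfold-low u w {x} x≤m with x ℕ.≤? m
    ... | yes _   = ≡.refl
    ... | no  x≰m = contradiction x≤m x≰m

    unfold-high : ∀ {u} w {x} → u m ≈ 0# → x ≤ m → unfold u w (N ∸ x) ≈ unfold⁺ u w x - u x
    unfold-high {u} w {x} um≈0 x≤m with (N ∸ x) ℕ.≤? m
    ... | no _ = reflexive (≡.cong (λ x → unfold⁺ u w x - u x) (ℕ.m∸[m∸n]≡n (ℕ.≤-trans x≤m m≤N)))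
    -- Only `x = m` falls here, since `x` and its mirror image are both at most `m`.
    ... | yes N∸x≤m
      with ≡.refl ← ℕ.≤-antisym x≤m (≡.subst₂ _≤_ N∸m≡m (ℕ.m∸[m∸n]≡n (ℕ.≤-trans x≤m m≤N))
          (ℕ.∸-monoʳ-≤ N N∸x≤m))
      = begin
      unfold⁺ u w (N ∸ m)      ≡⟨ ≡.cong (unfold⁺ u w) N∸m≡m ⟩
      unfold⁺ u w m            ≈⟨ a-0≈a _ ⟨
      unfold⁺ u w m - 0#       ≈⟨ +-congˡ (-‿cong um≈0) ⟨
      unfold⁺ u w m - u m      ∎

  -- The adjacency of an even cycle between its two parity classes; the eigenvalues 2 and -2 of the
  -- cycle sit here.
  exchange : Operator Bool
  exchange v b = v (not b) + v (not b)

  module _ (r : ℕ) where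

    private
      p m N : ℕ
      p = suc (suc r)
      m = suc p
      N = m ℕ.+ m

      V : Set c
      V = Fin N → Carrier

    open Folding p

    private
      1<pred-N : 1 < p ℕ.+ suc p
      1<pred-N = s≤s (s≤s z≤n)

      shift : Sequence → Sequence
      shift f x = f (suc x)

      unroll-N : (v : V) → unroll v N ≡ unroll v 0
      unroll-N v = ≡.trans (≡.cong (unroll v) (≡.sym (ℕ.+-identityʳ N))) (unroll-periodic v 0)

      unroll-N+ : (v : V) → ∀ x → unroll v (x ℕ.+ N) ≡ unroll v x
      unroll-N+ v x = ≡.trans (≡.cong (unroll v) (ℕ.+-comm x N)) (unroll-periodic v x)

    -- The fold about 1 is the fold about 0 of the shifted function. `false` holds the even sum and
    -- `true` the odd one. The dimensions match: `p + p + 2` is `N`.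
    split : V → (Fin p ⊎ Fin p) ⊎ Bool → Carrier
    split v (inj₁ (inj₁ i)) = folded (unroll v) i
    split v (inj₁ (inj₂ i)) = folded (shift (unroll v)) i
    split v (inj₂ false)    = evenSum m (unroll v)
    split v (inj₂ true)     = evenSum m (shift (unroll v))

    split-cong : ∀ {v w} → v ≋ w → split v ≋ split w
    split-cong v≋w (inj₁ (inj₁ i)) = fold-cong (λ x → v≋w (x mod N)) (suc (toℕ i))
    split-cong v≋w (inj₁ (inj₂ i)) = fold-cong (λ x → v≋w (suc x mod N)) (suc (toℕ i))
    split-cong v≋w (inj₂ false)    = evenSum-cong m λ x _ → v≋w (x mod N)
    split-cong v≋w (inj₂ true)     = evenSum-cong m λ x _ → v≋w (suc x mod N)

    split-+ : ∀ v w → split (λ x → v x + w x) ≋ (λ y → split v y + split w y)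
    split-+ v w (inj₁ (inj₁ i)) = fold-+ (unroll v) (unroll w) (suc (toℕ i))
    split-+ v w (inj₁ (inj₂ i)) = fold-+ (shift (unroll v)) (shift (unroll w)) (suc (toℕ i))
    split-+ v w (inj₂ false)    = evenSum-+ m (unroll v) (unroll w)
    split-+ v w (inj₂ true)     = evenSum-+ m (shift (unroll v)) (shift (unroll w))

    split-* : ∀ a v → split (λ x → a * v x) ≋ (λ y → a * split v y)
    split-* a v (inj₁ (inj₁ i)) = fold-* a (unroll v) (suc (toℕ i))
    split-* a v (inj₁ (inj₂ i)) = fold-* a (shift (unroll v)) (suc (toℕ i))
    split-* a v (inj₂ false)    = evenSum-* m a (unroll v)
    split-* a v (inj₂ true)     = evenSum-* m a (shift (unroll v))

    folded-intertwines : ∀ f g → f N ≈ f 0 → (∀ x → g (suc x) ≈ f x + f (suc (suc x))) →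
                         folded g ≋ neighbourSum (P p) (folded f)
    folded-intertwines f g fN≈f0 g≈f+f i = begin
      fold g (suc x)                                  ≈⟨ fold-step f g g≈f+f
          (ℕ.≤-trans (s≤s (s≤s (ℕ.<⇒≤ x<p))) 2+p≤N) ⟩
      fold f x + fold f (suc (suc x))                 ≈⟨ +-cong (pad-folded f fN≈f0 (ℕ.m<n⇒m≤1+n x<p))
          (pad-folded f fN≈f0 (s≤s x<p)) ⟨
      pad (folded f) x + pad (folded f) (suc (suc x)) ≈⟨ neighbourSum-P (folded f) i ⟨
      neighbourSum (P p) (folded f) i                    ∎
      where
      x = toℕ i
      x<p = toℕ<n i
      2+p≤N : suc (suc p) ≤ N
      2+p≤N = s≤s (≡.subst (suc p ≤_) (≡.sym (ℕ.+-suc p p)) (s≤s (ℕ.m≤m+n p p)))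

    -- Each vertex of the opposite parity neighbours two of the vertices summed over and is counted
    -- twice; periodicity brings the second copy back into range.
    evenSum-step : ∀ f g → f N ≈ f 0 → (∀ x → g (suc x) ≈ f x + f (suc (suc x))) →
                   evenSum m (shift g) ≈ evenSum m f + evenSum m f
    evenSum-step f g fN≈f0 g≈f+f = begin
      evenSum m (shift g)                               ≈⟨ evenSum-cong m (λ x _ → g≈f+f x) ⟩
      evenSum m (λ x → f x + f (suc (suc x)))           ≈⟨ evenSum-+ m f (shift (shift f)) ⟩
      evenSum m f + evenSum m (λ x → f (suc (suc x)))   ≈⟨ +-congˡ (evenSum-shift m f fN≈f0) ⟩
      evenSum m f + evenSum m f                         ∎

    split-intertwines : ∀ v → split (neighbourSum (C N) v) ≋
                        ((neighbourSum (P p) ⊕ neighbourSum (P p)) ⊕ exchange) (split v)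
    split-intertwines v (inj₁ (inj₁ i)) =
      folded-intertwines (unroll v) (unroll (neighbourSum (C N) v)) (reflexive (unroll-N v))
          (neighbourSum-C 1<pred-N v) i
    split-intertwines v (inj₁ (inj₂ i)) =
      folded-intertwines (shift (unroll v)) (shift (unroll (neighbourSum (C N) v)))
          (reflexive (unroll-N+ v 1)) (λ x → neighbourSum-C 1<pred-N v (suc x)) i
    split-intertwines v (inj₂ true) =
      evenSum-step (unroll v) (unroll (neighbourSum (C N) v)) (reflexive (unroll-N v))
          (neighbourSum-C 1<pred-N v)
    -- `evenSum-step` evaluates sums over odd positions. For the even sum it is applied to the
    -- shifted sequences, and the resulting shift by 2 is absorbed by periodicity.
    split-intertwines v (inj₂ false) = begin
      evenSum m (unroll Av)
        ≈⟨ evenSum-shift m (unroll Av) (reflexive (unroll-N Av)) ⟨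
      evenSum m (shift (shift (unroll Av)))
        ≈⟨ evenSum-step (shift (unroll v)) (shift (unroll Av)) (reflexive (unroll-N+ v 1))
            (λ x → neighbourSum-C 1<pred-N v (suc x)) ⟩
      evenSum m (shift (unroll v)) + evenSum m (shift (unroll v)) ∎
      where Av = neighbourSum (C N) v

    -- Vanishing folds give period 2, so each parity sum is `m` times a single value, and `m` can be
    -- cancelled.
    split-kernel : ∀ v → (∀ y → split v y ≈ 0#) → ∀ i → v i ≈ 0#
    split-kernel v split≈0 i = trans (reflexive (≡.sym (unroll-toℕ v i))) (vanishes (toℕ i) (toℕ<n i))
      where
      f = unroll v
      period-2 : ∀ {x} → x < N → f (suc (suc x)) ≈ f x
      period-2 = two-periodic f (reflexive (unroll-N v)) (reflexive (unroll-N+ v 1))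
                   (λ i → split≈0 (inj₁ (inj₁ i))) (λ i → split≈0 (inj₁ (inj₂ i)))
      -- Only the last position, `suc x = N`, lies outside the range of `period-2`; the period `N`
      -- carries it back to 0.
      period-2-shift : ∀ {x} → x < N → f (suc (suc (suc x))) ≈ f (suc x)
      period-2-shift {x} x<N with suc x ℕ.≟ N
      ... | no  1+x≢N = period-2 (ℕ.≤∧≢⇒< x<N 1+x≢N)
      ... | yes 1+x≡N = begin
        f (suc (suc (suc x)))   ≡⟨ ≡.cong (λ x → f (suc (suc x))) 1+x≡N ⟩
        f (suc (suc N))         ≡⟨ unroll-N+ v 2 ⟩
        f 2                     ≈⟨ period-2 (s≤s z≤n) ⟩
        f 0                     ≡⟨ unroll-N v ⟨
        f N                     ≡⟨ ≡.cong f 1+x≡N ⟨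
        f (suc x)               ∎
      vanishes : ∀ x → x < N → f x ≈ 0#
      vanishes zero _ = torsion-free p
        (trans (sym (evenSum-const m f λ x → period-2)) (split≈0 (inj₂ false)))
      vanishes (suc zero) _ = torsion-free p
        (trans (sym (evenSum-const m (shift f) λ x → period-2-shift)) (split≈0 (inj₂ true)))
      vanishes (suc (suc x)) 2+x<N = trans (period-2 x<N) (vanishes x x<N)
        where x<N = ℕ.<-trans (ℕ.n<1+n x) (ℕ.<-trans (ℕ.n<1+n (suc x)) 2+x<N)

    split-injective : ∀ {v w} → split v ≋ split w → v ≋ w
    split-injective {v} {w} sv≋sw i = x∙y⁻¹≈ε⇒x≈y _ _ (trans (+-congˡ (sym (-1*x≈-x (w i))))
      (split-kernel (λ i → v i + - 1# * w i) split≈0 i))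
      where
      split≈0 : ∀ y → split (λ i → v i + - 1# * w i) y ≈ 0#
      split≈0 y = begin
        split (λ i → v i + - 1# * w i) y            ≈⟨ split-+ v (λ i → - 1# * w i) y ⟩
        split v y + split (λ i → - 1# * w i) y      ≈⟨ +-cong (sv≋sw y) (trans (split-* (- 1#) w y)
            (-1*x≈-x _)) ⟩
        split w y - split w y                       ≈⟨ -‿inverseʳ _ ⟩
        0#                                          ∎

    module _ (a b : Carrier) where

      alternate : V
      alternate i = alternating a b (toℕ i)

      private
        alternating-N : alternating a b N ≡ alternating a b 0
        alternating-N = alternating-symmetric a b m {N} {0} (ℕ.+-identityʳ N)

        unroll-alternate : ∀ {x} → x ≤ N → unroll alternate x ≡ alternating a b x
        unroll-alternate {x} x≤N with x ℕ.≟ N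
        ... | no  x≢N    = unroll-sample (alternating a b) (ℕ.≤∧≢⇒< x≤N x≢N)
        ... | yes ≡.refl = ≡.trans (unroll-N alternate) (≡.sym alternating-N)

      -- Both reflections preserve parity, so alternating vectors are killed by both folds: they can
      -- adjust the parity sums without disturbing the path parts.
      split-alternate-path : ∀ y → split alternate (inj₁ y) ≈ 0#
      split-alternate-path (inj₁ i) = x≈y⇒x∙y⁻¹≈ε (begin
        unroll alternate x         ≡⟨ unroll-alternate x≤N ⟩
        alternating a b x          ≡⟨ alternating-symmetric a b m {x} {N ∸ x} (ℕ.m+[n∸m]≡n x≤N) ⟩
        alternating a b (N ∸ x)    ≡⟨ unroll-alternate (ℕ.m∸n≤m N x) ⟨
        unroll alternate (N ∸ x)   ∎)
        where
        x = suc (toℕ i)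
        x≤N : x ≤ N
        x≤N = ℕ.≤-trans (toℕ<n i) (ℕ.≤-trans (ℕ.n≤1+n p) m≤N)
      split-alternate-path (inj₂ i) = x≈y⇒x∙y⁻¹≈ε (begin
        unroll alternate (suc x)         ≡⟨ unroll-alternate 1+x≤N ⟩
        alternating a b (suc x)          ≡⟨ alternating-symmetric a b (suc m) {suc x} {suc (N ∸ x)}
            1+x+1+N∸x≡2[1+m] ⟩
        alternating a b (suc (N ∸ x))    ≡⟨ unroll-alternate (s≤s (ℕ.m∸n≤m (p ℕ.+ m) (toℕ i))) ⟨
        unroll alternate (suc (N ∸ x))   ∎)
        where
        x = suc (toℕ i)
        1+x≤N : suc x ≤ N
        1+x≤N = ℕ.≤-trans (s≤s (toℕ<n i)) m≤N
        1+x+1+N∸x≡2[1+m] : suc x ℕ.+ suc (N ∸ x) ≡ suc m ℕ.+ suc m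
        1+x+1+N∸x≡2[1+m] = ≡.cong suc (≡.trans (ℕ.+-suc x (N ∸ x))
          (≡.trans (≡.cong suc (ℕ.m+[n∸m]≡n (ℕ.<⇒≤ 1+x≤N))) (≡.sym (ℕ.+-suc m m))))

      split-alternate-even : split alternate (inj₂ false) ≈ m · a
      split-alternate-even = trans
        (evenSum-cong m λ x x<N → reflexive (unroll-alternate (ℕ.<⇒≤ x<N)))
        (evenSum-const m (alternating a b) λ _ _ → refl)

      split-alternate-odd : split alternate (inj₂ true) ≈ m · b
      split-alternate-odd = trans
        (evenSum-cong m λ x x<N → reflexive (unroll-alternate x<N))
        (evenSum-const m (shift (alternating a b)) λ _ _ → refl)

    module _ (u w : Fin p → Carrier) where

      unfolded : V
      unfolded i = unfold (pad u) (pad w) (toℕ i)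

      private
        f = unroll unfolded
        f⁺ = unfold⁺ (pad u) (pad w)

        pad-u-m : pad u m ≈ 0#
        pad-u-m = reflexive (extend-≥ u ℕ.≤-refl)

        m<N : m < N
        m<N = ℕ.m<m+n m (s≤s z≤n)

        low : ∀ {x} → x ≤ m → f x ≈ f⁺ x
        low x≤m = reflexive (≡.trans (unroll-sample (unfold (pad u) (pad w)) (ℕ.≤-<-trans x≤m m<N))
            (unfold-low (pad u) (pad w) x≤m))

        high : ∀ {x} → x ≤ m → f (N ∸ x) ≈ f⁺ x - pad u x
        -- Here the position is `N` itself, one past the sampled range, and wraps around to 0.
        high {zero}  _   = trans (reflexive (unroll-N unfolded)) (trans (low z≤n) (sym (a-0≈a _)))
        high {suc x} x≤m = trans (reflexive (unroll-sample (unfold (pad u) (pad w))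
            (s≤s (ℕ.m∸n≤m (p ℕ.+ m) x)))) (unfold-high (pad w) pad-u-m x≤m)

      split-unfolded : split unfolded ∘ inj₁ ≋ [ u , w ]
      split-unfolded (inj₁ i) = begin
        f (suc x) - f (N ∸ suc x)                    ≈⟨ +-cong (low x<m) (-‿cong (high x<m)) ⟩
        f⁺ (suc x) - (f⁺ (suc x) - pad u (suc x))    ≈⟨ a-[a-b]≈b _ _ ⟩
        extend u x                                   ≡⟨ extend-toℕ u i ⟩
        u i                                          ∎
        where
        x = toℕ i
        x<m : x < m
        x<m = ℕ.m<n⇒m<1+n (toℕ<n i)
      split-unfolded (inj₂ i) = begin
        f (suc (suc x)) - f (suc (N ∸ suc x))
          ≡⟨ ≡.cong (λ y → f (suc (suc x)) - f y) (1+[N∸1+x]≡N∸x (ℕ.≤-trans x<m m≤N)) ⟩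
        f (suc (suc x)) - f (N ∸ x)
          ≈⟨ +-cong (low (s≤s (toℕ<n i))) (-‿cong (high (ℕ.<⇒≤ x<m))) ⟩
        ((f⁺ x - pad u x) + extend w x) - (f⁺ x - pad u x)
          ≈⟨ xyx⁻¹≈y _ _ ⟩
        extend w x
          ≡⟨ extend-toℕ w i ⟩
        w i ∎
        where
        x = toℕ i
        x<m : x < m
        x<m = ℕ.m<n⇒m<1+n (toℕ<n i)

    -- `v₀` has the right path parts but uncontrolled parity sums; the alternating `v₁`, invisible
    -- to the path parts, supplies what the sums lack after division by `m`.
    split-surjective : ∀ w → ∃ λ v → split v ≋ w
    split-surjective w = (λ i → v₀ i + v₁ i) , λ y → trans (split-+ v₀ v₁ y) (sum≈w y)
      where
      v₀ = unfolded (w ∘ inj₁ ∘ inj₁) (w ∘ inj₁ ∘ inj₂)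
      solution = λ b → divide p (w (inj₂ b) - split v₀ (inj₂ b))
      a = proj₁ (solution false)
      b = proj₁ (solution true)
      v₁ = alternate a b
      path : ∀ y → split v₀ (inj₁ y) ≈ w (inj₁ y)
      path (inj₁ i) = split-unfolded (w ∘ inj₁ ∘ inj₁) (w ∘ inj₁ ∘ inj₂) (inj₁ i)
      path (inj₂ i) = split-unfolded (w ∘ inj₁ ∘ inj₁) (w ∘ inj₁ ∘ inj₂) (inj₂ i)
      sum≈w : ∀ y → split v₀ y + split v₁ y ≈ w y
      sum≈w (inj₁ y) = trans (+-cong (path y) (split-alternate-path a b y)) (+-identityʳ _)
      sum≈w (inj₂ false) = trans (+-congˡ (trans (split-alternate-even a b) (proj₂ (solution false))))
          (a+[b-a]≈b _ _)
      sum≈w (inj₂ true)  = trans (+-congˡ (trans (split-alternate-odd a b) (proj₂ (solution true))))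
          (a+[b-a]≈b _ _)

    C-≅-P⊕P⊕exchange : neighbourSum (C N) ≅ (neighbourSum (P p) ⊕ neighbourSum (P p)) ⊕ exchange
    C-≅-P⊕P⊕exchange = record
      { to          = split
      ; to-cong     = split-cong
      ; to-+        = split-+
      ; to-*        = split-*
      ; intertwines = split-intertwines
      ; injective   = split-injective
      ; surjective  = split-surjective
      }

  neighbourSum-congruent : ∀ G → Congruent (neighbourSum G)
  neighbourSum-congruent G = *ᵥ-congruent (λ i j → indicator (adj G i j))

  C∪P∪P : ℕ → ℕ → Graph
  C∪P∪P p q = C (suc p ℕ.+ suc p) ∪ P q ∪ P q

  C∪P∪P-≅ : ∀ p q → neighbourSum (C∪P∪P (2 ℕ.+ p) q) ≅
            (((neighbourSum (P (2 ℕ.+ p)) ⊕ neighbourSum (P (2 ℕ.+ p))) ⊕ exchange)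
              ⊕ neighbourSum (P q)) ⊕ neighbourSum (P q)
  C∪P∪P-≅ p q = ≅-trans (∪-≅-⊕ (C N ∪ P q) (P q))
    (⊕-cong (≅-trans (∪-≅-⊕ (C N) (P q)) (⊕-cong (C-≅-P⊕P⊕exchange p) ≅-refl)) ≅-refl)
    where N = (3 ℕ.+ p) ℕ.+ (3 ℕ.+ p)

  -- The symmetry between the two lengths enters here: each path operator occurs twice, once as a
  -- pair folded out of the cycle and once as a pair of components, around a common `D`.
  swap-summands : {X Y Z : Set} {A : Operator X} {B : Operator Y} {D : Operator Z} →
                  (((A ⊕ A) ⊕ D) ⊕ B) ⊕ B ≅ (((B ⊕ B) ⊕ D) ⊕ A) ⊕ A
  swap-summands {A = A} {B} {D} = ≅-relabel σ σ σ-involutive σ-involutive commutes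
    where
    σ : {X Y Z : Set} → (((X ⊎ X) ⊎ Z) ⊎ Y) ⊎ Y → (((Y ⊎ Y) ⊎ Z) ⊎ X) ⊎ X
    σ (inj₁ (inj₁ (inj₁ (inj₁ x)))) = inj₁ (inj₂ x)
    σ (inj₁ (inj₁ (inj₁ (inj₂ x)))) = inj₂ x
    σ (inj₁ (inj₁ (inj₂ z)))        = inj₁ (inj₁ (inj₂ z))
    σ (inj₁ (inj₂ y))               = inj₁ (inj₁ (inj₁ (inj₁ y)))
    σ (inj₂ y)                      = inj₁ (inj₁ (inj₁ (inj₂ y)))

    σ-involutive : {X Y Z : Set} → ∀ (i : (((X ⊎ X) ⊎ Z) ⊎ Y) ⊎ Y) → σ (σ i) ≡ i
    σ-involutive (inj₁ (inj₁ (inj₁ (inj₁ x)))) = ≡.refl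
    σ-involutive (inj₁ (inj₁ (inj₁ (inj₂ x)))) = ≡.refl
    σ-involutive (inj₁ (inj₁ (inj₂ z)))        = ≡.refl
    σ-involutive (inj₁ (inj₂ y))               = ≡.refl
    σ-involutive (inj₂ y)                      = ≡.refl

    commutes : ∀ v i → ((((A ⊕ A) ⊕ D) ⊕ B) ⊕ B) v (σ i) ≈ ((((B ⊕ B) ⊕ D) ⊕ A) ⊕ A) (v ∘ σ) i
    commutes v (inj₁ (inj₁ (inj₁ (inj₁ x)))) = refl
    commutes v (inj₁ (inj₁ (inj₁ (inj₂ x)))) = refl
    commutes v (inj₁ (inj₁ (inj₂ z)))        = refl
    commutes v (inj₁ (inj₂ y))               = refl
    commutes v (inj₂ y)                      = refl

  C∪P∪P-cospectral : ∀ p q → neighbourSum (C∪P∪P (2 ℕ.+ p) (2 ℕ.+ q)) ≅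
                             neighbourSum (C∪P∪P (2 ℕ.+ q) (2 ℕ.+ p))
  C∪P∪P-cospectral p q = ≅-trans (C∪P∪P-≅ p (2 ℕ.+ q)) (≅-trans swap-summands
    (≅-sym summands-congruent (C∪P∪P-≅ q (2 ℕ.+ p))))
    where
    summands-congruent = ⊕-congruent (⊕-congruent (⊕-congruent (⊕-congruent
      (neighbourSum-congruent (P (2 ℕ.+ q))) (neighbourSum-congruent (P (2 ℕ.+ q))))
      (λ v≋w b → +-cong (v≋w (not b)) (v≋w (not b))))
      (neighbourSum-congruent (P (2 ℕ.+ p)))) (neighbourSum-congruent (P (2 ℕ.+ p)))

  C∪P∪P-sameEigenvalues : ∀ p q →
    SameEigenvalueMultiset (λ i j → indicator (adj (C∪P∪P (2 ℕ.+ p) (2 ℕ.+ q)) i j))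
                           (λ i j → indicator (adj (C∪P∪P (2 ℕ.+ q) (2 ℕ.+ p)) i j))
  C∪P∪P-sameEigenvalues p q = ≅⇒sameEigenvalueMultiset (C∪P∪P-cospectral p q)

-- Cycles in graphs of maximum degree two.

module Cycles where

  open import Data.Empty using (⊥)
  open import Data.Fin.Properties using (↑ˡ-injective; ↑ʳ-injective; injective⇒≤; any?)
  open import Data.Fin.Subset using (_∈_)
  open import Data.Fin.Subset.Properties using (⊆-antisym)
  open import Data.List.Base using ([]; _∷_)
  open import Data.List.Relation.Unary.All using ([])
  open import Data.List.Relation.Unary.AllPairs using ([]; _∷_)
  open import Data.List.Relation.Unary.Any using (here)
  open import Data.Vec.Base using (tabulate; lookup)
  open import Data.Vec.Properties
    using (lookup∘tabulate; []=⇒lookup; lookup⇒[]=; tabulate∘lookup; tabulate-cong)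
  open import Function.Definitions using (Injective)
  open import Relation.Nullary.Decidable using (_×-dec_; dec-true)
  open import Data.Nat.Base using (_+_)
  open ≡
  open Defs

  -- Consecutive numbers are adjacent in `P n` and in `C n`, so one principle expresses the
  -- connectedness of both. Every vertex is reached by way of 0.
  connected : ∀ {n} (Q : Fin n → Set) →
              (∀ i j → suc (toℕ i) ≡ toℕ j ⊎ suc (toℕ j) ≡ toℕ i → Q i → Q j) →
              ∀ {i} → Q i → ∀ j → Q j
  connected {suc n} Q step q j = ascend Q (λ i j e → step i j (inj₁ e))
      (descend Q (λ i j e → step i j (inj₂ e)) _ q) j
    where
    ascend : ∀ {n} (Q : Fin (suc n) → Set) → (∀ i j → suc (toℕ i) ≡ toℕ j → Q i → Q j) →
             Q zero → ∀ j → Q j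
    ascend         Q up q zero    = q
    ascend {suc n} Q up q (suc j) =
      ascend (Q ∘ suc) (λ i j e → up (suc i) (suc j) (cong suc e)) (up zero (suc zero) refl q) j
    descend : ∀ {n} (Q : Fin (suc n) → Set) → (∀ i j → suc (toℕ j) ≡ toℕ i → Q i → Q j) →
              ∀ i → Q i → Q zero
    descend         Q down zero    q = q
    descend {suc n} Q down (suc i) q = down (suc zero) zero refl
      (descend (Q ∘ suc) (λ i j e → down (suc i) (suc j) (cong suc e)) i q)

  record Embedding (H G : Graph) : Set where
    field
      embed     : Vertex H → Vertex G
      injective : Injective _≡_ _≡_ embed
      hom       : ∀ a b → adj H a b ≡ true → adj G (embed a) (embed b) ≡ true

  open Embedding
  open Subgraph

  copyEmbedding : ∀ {H G S} → IsCopyOf H G S → Embedding H G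
  copyEmbedding copy = record { embed = C.embed ; injective = C.injective ; hom = C.hom }
    where module C = IsCopyOf copy

  _⨾_ : ∀ {F G H} → Embedding F G → Embedding G H → Embedding F H
  f ⨾ g = record
    { embed     = embed g ∘ embed f
    ; injective = injective f ∘ injective g
    ; hom       = λ a b → hom g _ _ ∘ hom f a b
    }

  identity : ∀ G → Embedding G G
  identity G = record { embed = λ i → i ; injective = λ e → e ; hom = λ _ _ e → e }

  module _ {G H : Graph} where

    private
      g = order G
      h = order H

    ∪-left : Embedding G (G ∪ H)
    ∪-left = record
      { embed     = _↑ˡ h
      ; injective = ↑ˡ-injective h _ _
      ; hom       = λ a b e → trans (cong₂ (adj⊎ G H) (splitAt-↑ˡ g a h) (splitAt-↑ˡ g b h)) e
      }

    ∪-right : Embedding H (G ∪ H)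
    ∪-right = record
      { embed     = g ↑ʳ_
      ; injective = ↑ʳ-injective g _ _
      ; hom       = λ a b e → trans (cong₂ (adj⊎ G H) (splitAt-↑ʳ g h a) (splitAt-↑ʳ g h b)) e
      }

  -- With the inclusion of a component as `ι`, this places a cycle inside that component, where it
  -- can be studied alone.
  Factors : ∀ {F G H} → Embedding F H → Embedding G H → Set
  Factors {F} {G} e ι = ∃ λ (f : Embedding F G) → ∀ a → embed e a ≡ embed ι (embed f a)

  module _ {n : ℕ} {G H : Graph} (e : Embedding (C (suc n)) (G ∪ H)) where

    private
      g = order G
      h = order H

      side : Vertex (C (suc n)) → Vertex G ⊎ Vertex H
      side a = splitAt g (embed e a)

      hom-step : ∀ {i j : Fin (suc n)} → suc (toℕ i) ≡ toℕ j ⊎ suc (toℕ j) ≡ toℕ i →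
                 adj⊎ G H (side i) (side j) ≡ true
      hom-step {i} {j} i~j = hom e i j (C-consecutive i~j)

      left-step : ∀ {i j} → adj⊎ G H i j ≡ true → (∃ λ x → i ≡ inj₁ x) → ∃ λ y → j ≡ inj₁ y
      left-step {j = inj₁ y} _ _          = y , refl
      left-step {j = inj₂ _} () (_ , refl)

      right-step : ∀ {i j} → adj⊎ G H i j ≡ true → (∃ λ x → i ≡ inj₂ x) → ∃ λ y → j ≡ inj₂ y
      right-step {j = inj₂ y} _ _          = y , refl
      right-step {j = inj₁ _} () (_ , refl)

      left : (∀ a → ∃ λ x → side a ≡ inj₁ x) → Factors e ∪-left
      left s = record
        { embed     = proj₁ ∘ s
        ; injective = λ {a} {b} x≡y → injective e (trans (eq a) (trans (cong (_↑ˡ h) x≡y) (sym (eq b))))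
        ; hom       = λ a b a~b → trans (sym (cong₂ (adj⊎ G H) (proj₂ (s a)) (proj₂ (s b)))) (hom e a b a~b)
        } , eq
        where
        eq : ∀ a → embed e a ≡ proj₁ (s a) ↑ˡ h
        eq a = sym (splitAt⁻¹-↑ˡ (proj₂ (s a)))

      right : (∀ a → ∃ λ x → side a ≡ inj₂ x) → Factors e ∪-right
      right s = record
        { embed     = proj₁ ∘ s
        ; injective = λ {a} {b} x≡y → injective e (trans (eq a) (trans (cong (g ↑ʳ_) x≡y) (sym (eq b))))
        ; hom       = λ a b a~b → trans (sym (cong₂ (adj⊎ G H) (proj₂ (s a)) (proj₂ (s b)))) (hom e a b a~b)
        } , eq
        where
        eq : ∀ a → embed e a ≡ g ↑ʳ proj₁ (s a)
        eq a = sym (splitAt⁻¹-↑ʳ (proj₂ (s a)))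

    -- No edge joins the two summands, so the side that contains the image of vertex 0 propagates
    -- along the cycle.
    cycle-in-∪ : Factors e ∪-left ⊎ Factors e ∪-right
    cycle-in-∪ with side zero in eq
    ... | inj₁ x = inj₁ (left (connected _ (λ i j s → left-step (hom-step s)) {zero} (x , eq)))
    ... | inj₂ x = inj₂ (right (connected _ (λ i j s → right-step (hom-step s)) {zero} (x , eq)))

  module _ {n : ℕ} (1<n : 1 < n) {G : Graph} (e : Embedding (C (suc n)) G) where

    private
      module N a = TwoNeighbours (C-neighbours 1<n a)

    -- The two neighbours of `a` would both have to go to `p`, against injectivity.
    no-leaf : ∀ a {i p} → embed e a ≡ i → OneNeighbour G i p → ⊥
    no-leaf a refl one = N.distinct a (injective e (trans
      (only _ (hom e _ _ (N.adjacent₁ a))) (sym (only _ (hom e _ _ (N.adjacent₂ a))))))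
      where open OneNeighbour one

    -- Two neighbours are mapped injectively into a set of two, hence onto it. The preimage is
    -- recorded as a neighbour of `a`, so that edges as well as vertices can be traced back.
    closed : ∀ a {p q} → TwoNeighbours G (embed e a) p q → ∀ w → adj G (embed e a) w ≡ true →
             ∃ λ b → adj (C (suc n)) a b ≡ true × embed e b ≡ w
    closed a two w a~w with only _ (hom e _ _ (N.adjacent₁ a)) | only _ (hom e _ _ (N.adjacent₂ a)) | only w
        a~w
      where open TwoNeighbours two
    ... | inj₁ x | inj₁ y | _ = contradiction (injective e (trans x (sym y))) (N.distinct a)
    ... | inj₂ x | inj₂ y | _ = contradiction (injective e (trans x (sym y))) (N.distinct a)
    ... | inj₁ x | inj₂ y | inj₁ z = prev a , N.adjacent₁ a , trans x (sym z)
    ... | inj₁ x | inj₂ y | inj₂ z = next a , N.adjacent₂ a , trans y (sym z)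
    ... | inj₂ x | inj₁ y | inj₁ z = next a , N.adjacent₂ a , trans y (sym z)
    ... | inj₂ x | inj₁ y | inj₂ z = prev a , N.adjacent₁ a , trans x (sym z)

  module _ {n : ℕ} (1<n : 1 < n) where

    -- An image closed under adjacency would spread to the end vertex 0, which is a leaf. While it
    -- spreads, a leaf is contradictory at once, so `closed` has to be invoked at inner vertices
    -- alone.
    no-cycle-in-P : ∀ {m} → Embedding (C (suc n)) (P (suc (suc m))) → ⊥
    no-cycle-in-P {m} e with connected _ step (zero , refl) zero
      where
      continue : ∀ {i} → PathVertex i → ∀ j → adj (P (suc (suc m))) i j ≡ true →
                 ∀ a → embed e a ≡ i → ∃ λ b → embed e b ≡ j
      continue first _ _ a ea≡i = contradiction (P-first m) (no-leaf 1<n e a ea≡i)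
      continue last  _ _ a ea≡i = contradiction (P-last m) (no-leaf 1<n e a ea≡i)
      continue (inner p q p→i i→q) j i~j a refl
        with b , _ , eb≡j ← closed 1<n e a (P-inner p→i i→q) j i~j = b , eb≡j

      step : ∀ i j → suc (toℕ i) ≡ toℕ j ⊎ suc (toℕ j) ≡ toℕ i →
             (∃ λ a → embed e a ≡ i) → ∃ λ b → embed e b ≡ j
      step i j i~j (a , ea≡i) = continue (pathVertex i) j (P-consecutive i~j) a ea≡i
    ... | a , ea≡0 = no-leaf 1<n e a ea≡0 (P-first m)

    module _ {m : ℕ} (1<m : 1 < m) (e : Embedding (C (suc n)) (C (suc m))) where

      cycle-onto : ∀ u → ∃ λ a → embed e a ≡ u
      cycle-onto = connected _ step (zero , refl)
        where
        step : ∀ i j → suc (toℕ i) ≡ toℕ j ⊎ suc (toℕ j) ≡ toℕ i →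
               (∃ λ a → embed e a ≡ i) → ∃ λ b → embed e b ≡ j
        step _ j i~j (a , refl)
          with b , _ , eb≡j ← closed 1<n e a (C-neighbours 1<m (embed e a)) j (C-consecutive i~j)
          = b , eb≡j

      -- Chosen preimages under a surjection form an injection in the other direction.
      cycle-lengths-≡ : suc n ≡ suc m
      cycle-lengths-≡ = ℕ.≤-antisym (injective⇒≤ (injective e))
        (injective⇒≤ {f = proj₁ ∘ cycle-onto} λ {u} {v} a≡b →
          trans (sym (proj₂ (cycle-onto u))) (trans (cong (embed e) a≡b) (proj₂ (cycle-onto v))))

  ∈-tabulate⇔ : ∀ {n} {Q : Fin n → Set} (Q? : ∀ i → Dec (Q i)) u →
                u ∈ tabulate (does ∘ Q?) ⇔ Q u
  ∈-tabulate⇔ {Q = Q} Q? u = mk⇔ to from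
    where
    to : u ∈ tabulate (does ∘ Q?) → Q u
    to u∈ with Q? u | trans (sym (lookup∘tabulate (does ∘ Q?) u)) ([]=⇒lookup u∈)
    ... | yes q | _  = q
    ... | no  _ | ()
    from : Q u → u ∈ tabulate (does ∘ Q?)
    from q = lookup⇒[]= u _ (trans (lookup∘tabulate (does ∘ Q?) u) (dec-true (Q? u) q))

  module _ {H G : Graph} (e : Embedding H G) where

    private
      hit? : ∀ u → Dec (∃ λ a → embed e a ≡ u)
      hit? u = any? λ a → embed e a Fin.≟ u

      edge? : ∀ u v → Dec (∃₂ λ a b → embed e a ≡ u × embed e b ≡ v × adj H a b ≡ true)
      edge? u v = any? λ a → any? λ b →
        (embed e a Fin.≟ u) ×-dec (embed e b Fin.≟ v) ×-dec (adj H a b Bool.≟ true)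

    -- Bit vectors require membership to be decided, which is a search through the finitely many
    -- vertices of `H`.
    image : Subgraph (order G)
    image = mkSubgraph (tabulate (does ∘ hit?)) (tabulate λ u → tabulate (does ∘ edge? u))

    image-isCopy : IsCopyOf H G image
    image-isCopy = record
      { embed      = embed e
      ; injective  = injective e
      ; hom        = hom e
      ; vertices⇔  = ∈-tabulate⇔ hit?
      ; neighbors⇔ = λ u v → subst (λ s → v ∈ s ⇔ (∃₂ λ a b → embed e a ≡ u × embed e b ≡ v × adj H a b ≡
          true))
                                     (sym (lookup∘tabulate _ u)) (∈-tabulate⇔ (edge? u) v)
      }

  module _ {n : ℕ} (1<n : 1 < n) {G : Graph} (ι : Embedding (C (suc n)) G) where

    private
      module _ {S S′ : Subgraph (order G)}
               (c : IsCopyOf (C (suc n)) G S) (c′ : IsCopyOf (C (suc n)) G S′)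
               (F : Factors (copyEmbedding c) ι) (F′ : Factors (copyEmbedding c′) ι) where

        module c = IsCopyOf c
        module c′ = IsCopyOf c′
        f = proj₁ F
        f′ = proj₁ F′

        vertices-⊆ : ∀ {u} → u ∈ vertices S → u ∈ vertices S′
        vertices-⊆ {u} u∈S
          with a , refl ← Equivalence.to (c.vertices⇔ u) u∈S
          with b , f′b≡fa ← cycle-onto 1<n 1<n f′ (embed f a)
          = Equivalence.from (c′.vertices⇔ u)
              (b , trans (proj₂ F′ b) (trans (cong (embed ι) f′b≡fa) (sym (proj₂ F a))))

        neighbors-⊆ : ∀ u {v} → v ∈ lookup (neighbors S) u → v ∈ lookup (neighbors S′) u
        neighbors-⊆ u {v} v∈
          with a , b , refl , refl , a~b ← Equivalence.to (c.neighbors⇔ u v) v∈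
          with a′ , f′a′≡fa ← cycle-onto 1<n 1<n f′ (embed f a)
          with b′ , a′~b′ , f′b′≡fb ← closed 1<n f′ a′ (C-neighbours 1<n (embed f′ a′)) (embed f b)
                 (trans (cong (λ x → adj (C (suc n)) x (embed f b)) f′a′≡fa) (hom f a b a~b))
          = Equivalence.from (c′.neighbors⇔ u v)
              ( a′ , b′
              , trans (proj₂ F′ a′) (trans (cong (embed ι) f′a′≡fa) (sym (proj₂ F a)))
              , trans (proj₂ F′ b′) (trans (cong (embed ι) f′b′≡fb) (sym (proj₂ F b)))
              , a′~b′)

    -- Inside the cycle `ι`, a cycle of the same length covers every vertex and, by `closed`, every
    -- edge. The inclusion of one copy in the other is symmetric in the two.
    copy-unique : ∀ {S S′} (c : IsCopyOf (C (suc n)) G S) (c′ : IsCopyOf (C (suc n)) G S′) →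
                  Factors (copyEmbedding c) ι → Factors (copyEmbedding c′) ι → S ≡ S′
    copy-unique {S} {S′} c c′ F F′ = cong₂ mkSubgraph
      (⊆-antisym (vertices-⊆ c c′ F F′) (vertices-⊆ c′ c F′ F))
      (begin
        neighbors S                         ≡⟨ tabulate∘lookup (neighbors S) ⟨
        tabulate (lookup (neighbors S))     ≡⟨ tabulate-cong (λ u → ⊆-antisym (neighbors-⊆ c c′ F F′ u)
            (neighbors-⊆ c′ c F′ F u)) ⟩
        tabulate (lookup (neighbors S′))    ≡⟨ tabulate∘lookup (neighbors S′) ⟩
        neighbors S′                        ∎)
      where
      open ≡-Reasoning

  module CyclesOf (N M p : ℕ) (1<N : 1 < N) (1<M : 1 < M) where

    G : Graph
    G = C (suc N) ∪ P (2 + p) ∪ P (2 + p) ∪ C (suc M)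

    ι₁ : Embedding (C (suc N)) G
    ι₁ = ∪-left ⨾ (∪-left ⨾ ∪-left {C (suc N) ∪ P (2 + p) ∪ P (2 + p)})

    ι₂ : Embedding (C (suc M)) G
    ι₂ = ∪-right {C (suc N) ∪ P (2 + p) ∪ P (2 + p)}

    -- `suc N` is the length of the original cycle and `suc M` that of the added one; the two may
    -- coincide. The factorisation is kept for the original cycle, whose copies are the ones
    -- counted.
    cycle-lengths : ∀ {n} → 1 < n → (e : Embedding (C (suc n)) G) →
                    (suc n ≡ suc N × Factors e ι₁) ⊎ suc n ≡ suc M
    cycle-lengths 1<n e with cycle-in-∪ e
    ... | inj₂ (f , _) = inj₂ (cycle-lengths-≡ 1<n 1<M f)
    ... | inj₁ (f , e≗) with cycle-in-∪ f
    ...   | inj₂ (f′ , _) = contradiction f′ (no-cycle-in-P 1<n)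
    ...   | inj₁ (f′ , f≗) with cycle-in-∪ f′
    ...     | inj₂ (f″ , _) = contradiction f″ (no-cycle-in-P 1<n)
    ...     | inj₁ (f″ , f′≗) = inj₁ (cycle-lengths-≡ 1<n 1<N f″ , f″ , λ a →
                trans (e≗ a) (cong (_↑ˡ _) (trans (f≗ a) (cong (_↑ˡ _) (f′≗ a)))))

    girth : M ≤ N → HasGirth G (suc M)
    girth M≤N = (image ι₂ , s≤s 1<M , image-isCopy ι₂) , minimal
      where
      minimal : ∀ ℓ S → IsCycle G ℓ S → suc M ≤ ℓ
      minimal (suc n) S (s≤s 1<n , c) with cycle-lengths 1<n (copyEmbedding c)
      ... | inj₁ (refl , _) = s≤s M≤N
      ... | inj₂ refl       = ℕ.≤-refl

    no-cycles : ∀ {n} → suc n ≢ suc N → suc n ≢ suc M → NumberOfCycles G (suc n) 0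
    no-cycles {n} n≢N n≢M = [] , [] , (λ S → mk⇔ (λ ()) impossible) , refl
      where
      impossible : ∀ {S} {A : Set} → IsCycle G (suc n) S → A
      impossible (s≤s 1<n , c) with cycle-lengths 1<n (copyEmbedding c)
      ... | inj₁ (e , _) = contradiction e n≢N
      ... | inj₂ e       = contradiction e n≢M

    one-cycle : suc N ≢ suc M → NumberOfCycles G (suc N) 1
    one-cycle N≢M = image ι₁ ∷ [] , [] ∷ [] , (λ S → mk⇔ to from) , refl
      where
      to : ∀ {S} → _ → IsCycle G (suc N) S
      to (here refl) = s≤s 1<N , image-isCopy ι₁
      from : ∀ {S} → IsCycle G (suc N) S → _
      from (_ , c) with cycle-lengths 1<N (copyEmbedding c)
      ... | inj₁ (_ , F) = here (copy-unique 1<N ι₁ c (image-isCopy ι₁) F (identity (C (suc N)) , λ _ →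
        refl))
      ... | inj₂ e = contradiction e N≢M

-- Bipartitions, degree sequences and half-regularity.

module Degrees where

  open import Data.Fin.Subset using (∣_∣)
  open import Data.List.Base using (List; []; _∷_; _++_; map; filter; replicate; tabulate)
  open import Data.List.Properties using (++-assoc)
  open import Data.List.Relation.Binary.Permutation.Propositional
    using (_↭_; ↭-reflexive; ↭-sym; ↭-trans; ↭⇒↭ₛ; prep; module PermutationReasoning)
  open import Data.List.Relation.Binary.Permutation.Propositional.Properties
    using (++⁺; ++⁺ʳ; ++-comm)
  open import Data.List.Relation.Binary.Pointwise using (Pointwise-≡⇒≡)
  open import Data.List.Relation.Unary.Sorted.TotalOrder.Properties using (↗↭↗⇒≋)
  import Data.Vec.Base as Vec
  open import Relation.Binary.Bundles using (DecTotalOrder)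
  import Relation.Binary.Construct.Flip.EqAndOrd as Flip
  open import Data.Nat.Base using (_+_; _*_)
  open ≡
  open Defs

  open IndicatorSum ℕ.+-*-semiring

  degree≡neighbourSum : ∀ G i → degree G i ≡ neighbourSum G (λ _ → 1) i
  degree≡neighbourSum G i = ∣tabulate∣ (adj G i)
    where
    ∣tabulate∣ : ∀ {n} (b : Fin n → Bool) → ∣ Vec.tabulate b ∣ ≡ indicator-sum b (λ _ → 1)
    ∣tabulate∣ {zero}  b = refl
    ∣tabulate∣ {suc n} b with b zero
    ... | true  = cong suc (∣tabulate∣ (b ∘ suc))
    ... | false = ∣tabulate∣ (b ∘ suc)

  degree-one : ∀ {G i p} → OneNeighbour G i p → degree G i ≡ 1
  degree-one {G} {i} one = trans (degree≡neighbourSum G i) (neighbourSum-one one λ _ → 1)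

  degree-two : ∀ {G i p q} → TwoNeighbours G i p q → degree G i ≡ 2
  degree-two {G} {i} two = trans (degree≡neighbourSum G i) (neighbourSum-two two λ _ → 1)

  C-degree : ∀ {n} → 1 < n → ∀ i → degree (C (suc n)) i ≡ 2
  C-degree 1<n i = degree-two (C-neighbours 1<n i)

  module _ (G H : Graph) where

    degree-↑ˡ : ∀ i → degree (G ∪ H) (i ↑ˡ order H) ≡ degree G i
    degree-↑ˡ i = trans (degree≡neighbourSum (G ∪ H) _)
      (trans (neighbourSum-↑ˡ G H _ i) (sym (degree≡neighbourSum G i)))

    degree-↑ʳ : ∀ j → degree (G ∪ H) (order G ↑ʳ j) ≡ degree H j
    degree-↑ʳ j = trans (degree≡neighbourSum (G ∪ H) _)
      (trans (neighbourSum-↑ʳ G H _ j) (sym (degree≡neighbourSum H j)))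

    infixl 6 _⊎ˢ_

    _⊎ˢ_ : (Vertex G → Bool) → (Vertex H → Bool) → Vertex (G ∪ H) → Bool
    (sideG ⊎ˢ sideH) i = [ sideG , sideH ]′ (splitAt (order G) i)

    module _ {sideG : Vertex G → Bool} {sideH : Vertex H → Bool} where

      ∪-isBipartition : IsBipartition G sideG → IsBipartition H sideH →
                        IsBipartition (G ∪ H) (sideG ⊎ˢ sideH)
      ∪-isBipartition bipG bipH i j i~j with splitAt (order G) i | splitAt (order G) j
      ... | inj₁ i′ | inj₁ j′ = bipG i′ j′ i~j
      ... | inj₂ i′ | inj₂ j′ = bipH i′ j′ i~j
      ... | inj₁ _  | inj₂ _  = contradiction i~j λ ()
      ... | inj₂ _  | inj₁ _  = contradiction i~j λ ()

      ∪-regularSide : ∀ {s d} → (∀ i → sideG i ≡ s → degree G i ≡ d) →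
                      (∀ j → sideH j ≡ s → degree H j ≡ d) →
                      ∀ i → (sideG ⊎ˢ sideH) i ≡ s → degree (G ∪ H) i ≡ d
      ∪-regularSide {s} {d} regG regH i = regular (splitAt (order G) i) refl
        where
        regular : ∀ x → splitAt (order G) i ≡ x → [ sideG , sideH ]′ x ≡ s → degree (G ∪ H) i ≡ d
        regular (inj₁ i′) eq i∈s = trans (cong (degree (G ∪ H)) (sym (splitAt⁻¹-↑ˡ eq)))
          (trans (degree-↑ˡ i′) (regG i′ i∈s))
        regular (inj₂ j′) eq i∈s = trans (cong (degree (G ∪ H)) (sym (splitAt⁻¹-↑ʳ {order G} eq)))
          (trans (degree-↑ʳ j′) (regH j′ i∈s))

  isEven : ℕ → Bool
  isEven zero          = true
  isEven (suc zero)    = false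
  isEven (suc (suc n)) = isEven n

  isEven-suc : ∀ n → isEven (suc n) ≡ not (isEven n)
  isEven-suc zero          = refl
  isEven-suc (suc zero)    = refl
  isEven-suc (suc (suc n)) = isEven-suc n

  isEven-pred : ∀ n → isEven (suc n) ≡ true → isEven n ≡ false
  isEven-pred n even = Bool.not-injective (trans (sym (isEven-suc n)) even)

  isEven-*2 : ∀ n → isEven (n * 2) ≡ true
  isEven-*2 zero    = refl
  isEven-*2 (suc n) = isEven-*2 n

  evenSide : ∀ {n} → Fin n → Bool
  evenSide i = isEven (toℕ i)

  consecutive⇒≢ : ∀ m n → suc m ≡ n ⊎ suc n ≡ m → isEven m ≢ isEven n
  consecutive⇒≢ m _ (inj₁ refl) eq = Bool.not-¬ (sym eq) (isEven-suc m)
  consecutive⇒≢ _ n (inj₂ refl) eq = Bool.not-¬ eq (isEven-suc n)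

  P-isBipartition : ∀ n → IsBipartition (P n) evenSide
  P-isBipartition n i j i~j = consecutive⇒≢ (toℕ i) (toℕ j) (P-adj⁻ {i = i} {j} i~j)

  C-isBipartition : ∀ {n} → isEven (suc n) ≡ true → IsBipartition (C (suc n)) evenSide
  C-isBipartition {n} even i j i~j i≡j with C-adj⁻ {i = i} {j} i~j
  ... | inj₁ consecutive = consecutive⇒≢ (toℕ i) (toℕ j) consecutive i≡j
  ... | inj₂ (inj₁ (i≡0 , j≡n)) = contradiction
    (trans (cong isEven (sym i≡0)) (trans i≡j (trans (cong isEven j≡n) (isEven-pred n even)))) λ ()
  ... | inj₂ (inj₂ (i≡n , j≡0)) = contradiction
    (trans (cong isEven (sym j≡0)) (trans (sym i≡j) (trans (cong isEven i≡n) (isEven-pred n even)))) λ ()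

  -- The number of vertices is odd, so both ends have even position and every odd position is inner.
  -- This gives the regular side.
  P-oddSide-degree : ∀ l (i : Fin (suc (suc l * 2))) → evenSide i ≡ false →
                     degree (P (suc (suc l * 2))) i ≡ 2
  P-oddSide-degree l i odd with pathVertex i
  ... | first = contradiction odd λ ()
  ... | last  = contradiction (trans (sym (isEven-*2 (suc l)))
    (trans (sym (cong isEven (toℕ-fromℕ (suc l * 2)))) odd)) λ ()
  ... | inner p q p→i i→q = degree-two (P-inner p→i i→q)

  -- Mapping and filtering merged into one recursion over `Fin`, which splits along disjoint unions
  -- and computes two vertices at a time on alternating sides.
  select : ∀ (s : Bool) {n} → (Fin n → Bool) → (Fin n → ℕ) → List ℕ
  select s {zero}  side d = []
  select s {suc n} side d with does (side zero Bool.≟ s)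
  ... | true  = d zero ∷ select s (side ∘ suc) (d ∘ suc)
  ... | false = select s (side ∘ suc) (d ∘ suc)

  map-filter-tabulate : ∀ {A : Set} s (side : A → Bool) (d : A → ℕ) {n} (f : Fin n → A) →
                        map d (filter (λ x → side x Bool.≟ s) (tabulate f)) ≡
                        select s (side ∘ f) (d ∘ f)
  map-filter-tabulate s side d {zero}  f = refl
  map-filter-tabulate s side d {suc n} f with does (side (f zero) Bool.≟ s)
  ... | true  = cong (d (f zero) ∷_) (map-filter-tabulate s side d (f ∘ suc))
  ... | false = map-filter-tabulate s side d (f ∘ suc)

  select-cong : ∀ s {n} {side side′ : Fin n → Bool} {d d′ : Fin n → ℕ} →
                (∀ i → side i ≡ side′ i) → (∀ i → d i ≡ d′ i) → select s side d ≡ select s side′ d′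
  select-cong s {zero}  side≗ d≗ = refl
  select-cong s {suc n} {side} {side′} side≗ d≗ rewrite side≗ zero with does (side′ zero Bool.≟ s)
  ... | true  = cong₂ _∷_ (d≗ zero) (select-cong s (side≗ ∘ suc) (d≗ ∘ suc))
  ... | false = select-cong s (side≗ ∘ suc) (d≗ ∘ suc)

  select-+ : ∀ s m {n} (side : Fin (m + n) → Bool) d →
             select s side d ≡ select s (side ∘ (_↑ˡ n)) (d ∘ (_↑ˡ n)) ++
                                 select s (side ∘ (m ↑ʳ_)) (d ∘ (m ↑ʳ_))
  select-+ s zero    side d = refl
  select-+ s (suc m) side d with does (side zero Bool.≟ s)
  ... | true  = cong (d zero ∷_) (select-+ s m (side ∘ suc) (d ∘ suc))
  ... | false = select-+ s m (side ∘ suc) (d ∘ suc)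

  degrees : ∀ G → (Vertex G → Bool) → Bool → List ℕ
  degrees G side s = select s side (degree G)

  degrees-∪ : ∀ G H sideG sideH s → degrees (G ∪ H) (_⊎ˢ_ G H sideG sideH) s ≡
              degrees G sideG s ++ degrees H sideH s
  degrees-∪ G H sideG sideH s = trans (select-+ s (order G) _ _) (cong₂ _++_
    (select-cong s (λ i → cong [ sideG , sideH ]′ (splitAt-↑ˡ (order G) i (order H))) (degree-↑ˡ G H))
    (select-cong s (λ j → cong [ sideG , sideH ]′ (splitAt-↑ʳ (order G) (order H) j)) (degree-↑ʳ G H)))

  open DecTotalOrder (Flip.decTotalOrder ℕ.≤-decTotalOrder) using (totalOrder)

  -- A sorted list is determined by the multiset of its entries.
  sort-cong : ∀ {xs ys} → xs ↭ ys → Descending.sort xs ≡ Descending.sort ys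
  sort-cong {xs} {ys} xs↭ys = Pointwise-≡⇒≡
    (↗↭↗⇒≋ totalOrder (Descending.sort-↗ xs) (Descending.sort-↗ ys)
      (↭⇒↭ₛ (↭-trans (Descending.sort-↭ xs) (↭-trans xs↭ys (↭-sym (Descending.sort-↭ ys))))))

  degrees-↭⇒degreeSequence-≡ : ∀ G H sideG sideH s → degrees G sideG s ↭ degrees H sideH s →
                               degreeSequence G sideG s ≡ degreeSequence H sideH s
  degrees-↭⇒degreeSequence-≡ G H sideG sideH s ↭ = sort-cong
    (subst₂ _↭_ (sym (map-filter-tabulate s sideG (degree G) (λ i → i)))
                (sym (map-filter-tabulate s sideH (degree H) (λ j → j))) ↭)

  replicate-+ : ∀ m n {x : ℕ} → replicate (m + n) x ≡ replicate m x ++ replicate n x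
  replicate-+ zero    n = refl
  replicate-+ (suc m) n = cong (_ ∷_) (replicate-+ m n)

  select-regular : ∀ s m {n} → n ≡ m * 2 → {d : Fin n → ℕ} → (∀ i → evenSide i ≡ s → d i ≡ 2) →
                   select s evenSide d ≡ replicate m 2
  select-regular s     zero    refl d≡2 = refl
  select-regular true  (suc m) refl d≡2 = cong₂ _∷_ (d≡2 zero refl) (select-regular true m refl
      (λ i → d≡2 (suc (suc i))))
  select-regular false (suc m) refl d≡2 = cong₂ _∷_ (d≡2 (suc zero) refl) (select-regular false m refl
      (λ i → d≡2 (suc (suc i))))

  C-degrees : ∀ s m {n} → 1 < n → suc n ≡ m * 2 → degrees (C (suc n)) evenSide s ≡ replicate m 2
  C-degrees s m 1<n eq = select-regular s m eq (λ i _ → C-degree 1<n i)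

  P-oddSide-degrees : ∀ l → degrees (P (suc (suc l * 2))) evenSide false ≡ replicate (suc l) 2
  P-oddSide-degrees l = select-odd (suc l) (P-oddSide-degree l)
    where
    select-odd : ∀ m {d : Fin (suc (m * 2)) → ℕ} → (∀ i → evenSide i ≡ false → d i ≡ 2) →
                 select false evenSide d ≡ replicate m 2
    select-odd zero    d≡2 = refl
    select-odd (suc m) d≡2 = cong₂ _∷_ (d≡2 (suc zero) refl) (select-odd m (λ i → d≡2 (suc (suc i))))

  P-evenSide-degrees : ∀ l → degrees (P (suc (suc l * 2))) evenSide true ↭ 1 ∷ 1 ∷ replicate l 2
  P-evenSide-degrees l = ↭-trans
    (↭-reflexive (cong₂ _∷_ (degree-one {P (suc (suc l * 2))} {zero} (P-first (suc (l * 2))))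
      (select-tail l (λ i → degree (P (suc (suc l * 2))) (suc (suc i))) inner-degree last-degree)))
    -- The last vertex leaves its 1 at the end of the list; it moves next to the 1 of the first
    -- vertex.
    (prep 1 (++-comm (replicate l 2) (1 ∷ [])))
    where
    select-tail : ∀ m (d : Fin (suc (m * 2)) → ℕ) → (∀ i → toℕ i < m * 2 → d i ≡ 2) → d (fromℕ (m * 2)) ≡
        1 →
                  select true evenSide d ≡ replicate m 2 ++ 1 ∷ []
    select-tail zero    d d≡2 d≡1 = cong (_∷ []) d≡1
    select-tail (suc m) d d≡2 d≡1 = cong₂ _∷_ (d≡2 zero (s≤s z≤n))
      (select-tail m (λ i → d (suc (suc i))) (λ i i<2m → d≡2 (suc (suc i)) (s≤s (s≤s i<2m))) d≡1)
    last-degree : degree (P (suc (suc l * 2))) (fromℕ (suc l * 2)) ≡ 1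
    last-degree = degree-one (P-last (suc (l * 2)))
    inner-degree : ∀ (i : Fin (suc (l * 2))) → toℕ i < l * 2 →
                   degree (P (suc (suc l * 2))) (suc (suc i)) ≡ 2
    inner-degree i i<2l = helper (pathVertex (suc (suc i))) refl
      where
      helper : ∀ {j} → PathVertex j → suc (suc (toℕ i)) ≡ toℕ j → degree (P (suc (suc l * 2))) j ≡ 2
      helper last e = contradiction (trans e (toℕ-fromℕ (suc l * 2))) (ℕ.<⇒≢ (s≤s (s≤s i<2l)))
      helper (inner p q p→j j→q) _ = degree-two (P-inner p→j j→q)

  module _ {N : ℕ} (1<N : 1 < N) (l : ℕ) where

    private
      p : ℕ
      p = suc (suc l * 2)

    C∪P∪P-side : Vertex (C (suc N) ∪ P p ∪ P p) → Bool
    C∪P∪P-side = _⊎ˢ_ (C (suc N) ∪ P p) (P p) (_⊎ˢ_ (C (suc N)) (P p) evenSide evenSide) evenSide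

    C∪P∪P-isBipartition : isEven (suc N) ≡ true → IsBipartition (C (suc N) ∪ P p ∪ P p) C∪P∪P-side
    C∪P∪P-isBipartition even = ∪-isBipartition (C (suc N) ∪ P p) (P p)
      (∪-isBipartition (C (suc N)) (P p) (C-isBipartition even) (P-isBipartition p)) (P-isBipartition p)

    C∪P∪P-isHalfRegular : isEven (suc N) ≡ true → IsHalfRegular (C (suc N) ∪ P p ∪ P p)
    C∪P∪P-isHalfRegular even =
      (C∪P∪P-side , C∪P∪P-isBipartition even , false , 2 ,
        ∪-regularSide (C (suc N) ∪ P p) (P p)
          (∪-regularSide (C (suc N)) (P p) (λ i _ → C-degree 1<N i) (P-oddSide-degree l))
          (P-oddSide-degree l)) ,
      not-biRegular
      where
      G = C (suc N) ∪ P p ∪ P p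

      c : Fin (suc N) → Vertex G
      c i = (i ↑ˡ p) ↑ˡ p

      c-degree : ∀ i → degree G (c i) ≡ 2
      c-degree i = trans (degree-↑ˡ (C (suc N) ∪ P p) (P p) (i ↑ˡ p))
        (trans (degree-↑ˡ (C (suc N)) (P p) i) (C-degree 1<N i))

      end : Vertex G
      end = order (C (suc N) ∪ P p) ↑ʳ zero

      end-degree : degree G end ≡ 1
      end-degree = trans (degree-↑ʳ (C (suc N) ∪ P p) (P p) zero) (degree-one {P (suc (suc l * 2))} {zero}
          (P-first (suc (l * 2))))

      -- Two adjacent vertices of the cycle cover both sides.
      c-on-side : ∀ side → IsBipartition G side → ∀ s → ∃ λ i → side (c i) ≡ s
      c-on-side side bip s with side (c zero) Bool.≟ s | side (c (next zero)) Bool.≟ s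
      ... | yes e | _     = zero , e
      ... | no  _ | yes e = next zero , e
      ... | no ≢₀ | no ≢₁ = contradiction
        (trans (Bool.¬-not ≢₀) (sym (Bool.¬-not ≢₁)))
        (bip _ _ (trans (cong₂ (adj⊎ (C (suc N) ∪ P p) (P p)) (splitAt-↑ˡ _ (zero ↑ˡ p) p)
            (splitAt-↑ˡ _ (next zero ↑ˡ p) p))
          (trans (cong₂ (adj⊎ (C (suc N)) (P p)) (splitAt-↑ˡ _ zero p) (splitAt-↑ˡ _ (next zero) p))
            (TwoNeighbours.adjacent₂ (C-neighbours 1<N zero)))))

      -- For any bipartition, the side that holds a path end, of degree 1, also holds a cycle
      -- vertex, of degree 2.
      not-biRegular : ¬ IsBiRegular G
      not-biRegular (side , bip , regular)
        with i , ci∈ ← c-on-side side bip (side end)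
           | d , reg ← regular (side end)
        = contradiction (trans (sym end-degree) (trans (reg end refl) (trans (sym (reg (c i) ci∈))
            (c-degree i)))) λ ()

    private
      degrees-∪-∪ : ∀ s → degrees (C (suc N) ∪ P p ∪ P p) C∪P∪P-side s ≡
                    (degrees (C (suc N)) evenSide s ++ degrees (P p) evenSide s) ++
                    degrees (P p) evenSide s
      degrees-∪-∪ s = trans (degrees-∪ (C (suc N) ∪ P p) (P p) (_⊎ˢ_ (C (suc N)) (P p) evenSide evenSide)
          evenSide s)
        (cong (_++ degrees (P p) evenSide s) (degrees-∪ (C (suc N)) (P p) evenSide evenSide s))

    C∪P∪P-oddSide-degrees : ∀ {m} → suc N ≡ m * 2 →
      degrees (C (suc N) ∪ P p ∪ P p) C∪P∪P-side false ≡ replicate ((m + suc l) + suc l) 2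
    C∪P∪P-oddSide-degrees {m} eq = trans (degrees-∪-∪ false) (trans
      (cong₂ _++_ (cong₂ _++_ (C-degrees false m 1<N eq) (P-oddSide-degrees l)) (P-oddSide-degrees l))
      (sym (trans (replicate-+ (m + suc l) (suc l)) (cong (_++ replicate (suc l) 2)
          (replicate-+ m (suc l))))))

    -- The entries 1 stem from the four ends of the two paths, all of which lie on the even side.
    C∪P∪P-evenSide-degrees : ∀ {m} → suc N ≡ m * 2 →
      degrees (C (suc N) ∪ P p ∪ P p) C∪P∪P-side true ↭ 1 ∷ 1 ∷ 1 ∷ 1 ∷ replicate ((m + l) + l) 2
    C∪P∪P-evenSide-degrees {m} eq = begin
      degrees (C (suc N) ∪ P p ∪ P p) C∪P∪P-side true
        ≡⟨ degrees-∪-∪ true ⟩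
      (degrees (C (suc N)) evenSide true ++ degrees (P p) evenSide true) ++ degrees (P p) evenSide true
        ↭⟨ ++⁺ (++⁺ (↭-reflexive (C-degrees true m 1<N eq)) (P-evenSide-degrees l)) (P-evenSide-degrees l) ⟩
      (replicate m 2 ++ 1 ∷ 1 ∷ replicate l 2) ++ 1 ∷ 1 ∷ replicate l 2
        ↭⟨ move (replicate m 2 ++ 1 ∷ 1 ∷ replicate l 2) (replicate l 2) ⟩
      1 ∷ 1 ∷ ((replicate m 2 ++ 1 ∷ 1 ∷ replicate l 2) ++ replicate l 2)
        ↭⟨ prep 1 (prep 1 (++⁺ʳ (replicate l 2) (move (replicate m 2) (replicate l 2)))) ⟩
      1 ∷ 1 ∷ 1 ∷ 1 ∷ ((replicate m 2 ++ replicate l 2) ++ replicate l 2)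
        ≡⟨ cong (λ xs → 1 ∷ 1 ∷ 1 ∷ 1 ∷ xs) (trans (replicate-+ (m + l) l) (cong (_++ replicate l 2)
            (replicate-+ m l))) ⟨
      1 ∷ 1 ∷ 1 ∷ 1 ∷ replicate ((m + l) + l) 2 ∎
      where
      open PermutationReasoning
      move : ∀ xs ys → xs ++ 1 ∷ 1 ∷ ys ↭ 1 ∷ 1 ∷ (xs ++ ys)
      move xs ys = ↭-trans (↭-reflexive (sym (++-assoc xs (1 ∷ 1 ∷ []) ys)))
          (++⁺ʳ ys (++-comm xs (1 ∷ 1 ∷ [])))

-- Division by positive integers in the reals.

module ℝInverse where

  open import Data.Rational.Base as ℚ using (1ℚ)
  import Data.Rational.Properties as ℚ
  open Defs
  open SemiringMult (CommutativeRing.semiring ℝ-commutativeRing) using () renaming (_×_ to _·_)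
  open SemiringMult (CommutativeRing.semiring ℚ.+-*-commutativeRing) using () renaming (_×_ to _·ℚ_)
  open ≡

  ·1-positive : ∀ n → ℚ.Positive (suc n ·ℚ 1ℚ)
  ·1-positive zero    = _
  ·1-positive (suc n) = ℚ.pos+pos⇒pos 1ℚ (suc n ·ℚ 1ℚ) {{·1-positive n}}

  seq-· : ∀ n k → seq (n · 1ᴿ) k ≡ n ·ℚ 1ℚ
  seq-· zero    k = refl
  seq-· (suc n) k = cong (1ℚ ℚ.+_) (seq-· n k)

  -- A multiple of `1ᴿ` is a constant sequence, so the constant sequence at the rational inverse
  -- inverts it.
  ℝ-inverse : HasInverses ℝ-commutativeRing
  ℝ-inverse n = fromℚ (ℚ.1/ q) , pointwise λ k →
    trans (cong (ℚ.1/ q ℚ.*_) (seq-· (suc n) k)) (ℚ.*-inverseˡ q)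
    where
    q = suc n ·ℚ 1ℚ
    instance _ = ℚ.pos⇒nonZero q {{·1-positive n}}

-- The lengths of the theorem.

open import Data.List.Base using (_∷_; replicate)
open import Data.List.Relation.Binary.Permutation.Propositional
  using (↭-reflexive; ↭-sym; ↭-trans)
open import Data.Nat.Base using (_+_; _*_)
open import Data.Nat.Divisibility using (_∣_; divides)
open import Data.Nat.Tactic.RingSolver using (solve-∀)
open ≡
open import Defs
open Cycles
open Degrees

-- The four lengths are variables, so that different arithmetic expressions for them can be
-- exchanged by substitution.
Conclusion : (N N′ a b : ℕ) → Set
Conclusion N N′ a b =
  let G₁ = C N ∪ P b ∪ P b
      G₂ = C N′ ∪ P a ∪ P a
  in IsHalfRegular G₁ × IsHalfRegular G₂ ×
     SameDegreeSequences G₁ G₂ ×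
     SameSpectrum G₁ G₂ ×
     HasGirth (G₁ ∪ C N) N ×
     HasGirth (G₂ ∪ C N) N ×
     DifferentNumbersOfCycles (G₁ ∪ C N) (G₂ ∪ C N) N′

-- With `k = suc l` this is `2 * k + 1`; its successor is half the length of the corresponding
-- cycle.
odd≥3 : ℕ → ℕ
odd≥3 l = suc (suc l * 2)

private

  n+n≡n*2 : ∀ n → n + n ≡ n * 2
  n+n≡n*2 = solve-∀

  2k+1 : ∀ l → suc (suc l * 2) ≡ 2 * suc l + 1
  2k+1 = solve-∀

  4[k+1] : ∀ l → suc (suc (suc l * 2)) + suc (suc (suc l * 2)) ≡ 4 * (suc l + 1)
  4[k+1] = solve-∀

  2[k′+1] : ∀ n → suc n + suc n ≡ 2 * (n + 1)
  2[k′+1] = solve-∀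

  -- The cycle puts `2l + 4` vertices on each side and each path on `2l′ + 3` vertices has `l′ + 1`
  -- odd positions. The total `2l + 2l′ + 6` is symmetric in `l` and `l′`.
  oddSide-count : ∀ l l′ → (suc (suc (suc l * 2)) + suc l′) + suc l′ ≡ (suc (suc (suc l′ * 2)) + suc l) +
      suc l
  oddSide-count = solve-∀

  evenSide-count : ∀ l l′ → (suc (suc (suc l * 2)) + l′) + l′ ≡ (suc (suc (suc l′ * 2)) + l) + l
  evenSide-count = solve-∀

conclusion : ∀ {l l′} → l < l′ →
  Conclusion (suc (odd≥3 l) + suc (odd≥3 l)) (suc (odd≥3 l′) + suc (odd≥3 l′)) (odd≥3 l) (odd≥3 l′)
conclusion {l} {l′} l<l′ =
  C∪P∪P-isHalfRegular 1<N l′ even-N ,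
  C∪P∪P-isHalfRegular 1<N′ l even-N′ ,
  (C∪P∪P-side 1<N l′ , C∪P∪P-side 1<N′ l ,
   C∪P∪P-isBipartition 1<N l′ even-N , C∪P∪P-isBipartition 1<N′ l even-N′ , degreeSequences) ,
  Decomposition.C∪P∪P-sameEigenvalues ℝ-commutativeRing ℝInverse.ℝ-inverse (suc (l * 2)) (suc (l′ * 2)) ,
  CyclesOf.girth N N (suc (l′ * 2)) 1<N 1<N ℕ.≤-refl ,
  CyclesOf.girth N′ N (suc (l * 2)) 1<N′ 1<N (ℕ.≤-pred (ℕ.<⇒≤ N<N′)) ,
  -- Every cycle of the first union has length `suc N`, less than `suc N′`; in the second union the
  -- original cycle is the only one of length `suc N′`.
  0 , 1 ,
  CyclesOf.no-cycles N N (suc (l′ * 2)) 1<N 1<N (ℕ.<⇒≢ N<N′ ∘ sym) (ℕ.<⇒≢ N<N′ ∘ sym) ,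
  CyclesOf.one-cycle N′ N (suc (l * 2)) 1<N′ 1<N (ℕ.<⇒≢ N<N′ ∘ sym) ,
  λ ()
  where
  a b N N′ : ℕ
  a  = odd≥3 l
  b  = odd≥3 l′
  N  = a + suc a
  N′ = b + suc b

  G₁ = C (suc N) ∪ P b ∪ P b
  G₂ = C (suc N′) ∪ P a ∪ P a

  1<N : 1 < N
  1<N = s≤s (s≤s z≤n)

  1<N′ : 1 < N′
  1<N′ = s≤s (s≤s z≤n)

  even-N : isEven (suc N) ≡ true
  even-N = trans (cong isEven (n+n≡n*2 (suc a))) (isEven-*2 (suc a))

  even-N′ : isEven (suc N′) ≡ true
  even-N′ = trans (cong isEven (n+n≡n*2 (suc b))) (isEven-*2 (suc b))

  N<N′ : suc N < suc N′
  N<N′ = ℕ.+-mono-< suc-a<suc-b suc-a<suc-b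
    where
    suc-a<suc-b : suc a < suc b
    suc-a<suc-b = s≤s (s≤s (ℕ.*-monoˡ-< 2 (s≤s l<l′)))

  degreeSequences : ∀ s → degreeSequence G₁ (C∪P∪P-side 1<N l′) s ≡
                          degreeSequence G₂ (C∪P∪P-side 1<N′ l) s
  degreeSequences false = degrees-↭⇒degreeSequence-≡ G₁ G₂ (C∪P∪P-side 1<N l′) (C∪P∪P-side 1<N′ l) false
      (↭-reflexive (trans
    (C∪P∪P-oddSide-degrees 1<N l′ (n+n≡n*2 (suc a)))
    (trans (cong (λ n → replicate n 2) (oddSide-count l l′))
           (sym (C∪P∪P-oddSide-degrees 1<N′ l (n+n≡n*2 (suc b)))))))
  degreeSequences true = degrees-↭⇒degreeSequence-≡ G₁ G₂ (C∪P∪P-side 1<N l′) (C∪P∪P-side 1<N′ l) true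
      (↭-trans
    (C∪P∪P-evenSide-degrees 1<N l′ (n+n≡n*2 (suc a)))
    (↭-trans (↭-reflexive (cong (λ n → 1 ∷ 1 ∷ 1 ∷ 1 ∷ replicate n 2) (evenSide-count l l′)))
             (↭-sym (C∪P∪P-evenSide-degrees 1<N′ l (n+n≡n*2 (suc b))))))

¬2∣⇒odd : ∀ {n} → ¬ (2 ∣ n) → ∃ λ h → n ≡ suc (h * 2)
¬2∣⇒odd {zero}        2∤n = contradiction (divides 0 refl) 2∤n
¬2∣⇒odd {suc zero}    2∤n = 0 , refl
¬2∣⇒odd {suc (suc n)} 2∤n
  with h , n≡1+2h ← ¬2∣⇒odd {n} (λ { (divides q n≡2q) → 2∤n (divides (suc q) (cong (2 +_) n≡2q)) })
  = suc h , cong (2 +_) n≡1+2h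

mainTheorem10 : (k k′ : ℕ) → 1 ≤ k → ¬ (2 ∣ k′) → 2 * k + 1 < k′ →
  let G₁ = C (4 * (k + 1)) ∪ P k′ ∪ P k′
      G₂ = C (2 * (k′ + 1)) ∪ P (2 * k + 1) ∪ P (2 * k + 1)
  in IsHalfRegular G₁ × IsHalfRegular G₂ ×
     SameDegreeSequences G₁ G₂ ×
     SameSpectrum G₁ G₂ ×
     HasGirth (G₁ ∪ C (4 * (k + 1))) (4 * (k + 1)) ×
     HasGirth (G₂ ∪ C (4 * (k + 1))) (4 * (k + 1)) ×
     DifferentNumbersOfCycles (G₁ ∪ C (4 * (k + 1))) (G₂ ∪ C (4 * (k + 1))) (2 * (k′ + 1))
mainTheorem10 (suc l) k′ _ 2∤k′ 2k+1<k′ with ¬2∣⇒odd 2∤k′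
-- From `2k + 1 < 2h + 1` follows `suc l < h`. Hence `h` is some `suc l′` with `l < l′`, and `k′` is
-- `odd≥3 l′`.
... | h , refl with h | ℕ.*-cancelʳ-< 2 (suc l) h (ℕ.≤-pred (subst (_< suc (h * 2)) (sym (2k+1 l)) 2k+1<k′))
... | suc l′ | s≤s l<l′ =
  subst₂ (λ N N′ → Conclusion N N′ (2 * suc l + 1) (odd≥3 l′)) (4[k+1] l) (2[k′+1] (odd≥3 l′))
    (subst (λ a → Conclusion (suc (odd≥3 l) + suc (odd≥3 l)) (suc (odd≥3 l′) + suc (odd≥3 l′)) a (odd≥3 l′))
      (2k+1 l) (conclusion l<l′))
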